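{- Let $\mathcal B(n,l)$ be the reflection algebra with generating matrix $B(u)$ and Sklyanin determinant $\operatorname{sdet}B(u)$. For $k=1,\dots,n$ define $$\Pi_k:=1-\frac{1}{2u-k-n+2}\sum_{i=k+1}^{n}P_{ki},$$ and put $$\langle\langle B_1,\dots,B_n\rangle\rangle:=B_1(u)\,\Pi_1\,B_2(u-1)\,\Pi_2\cdots B_{n-1}(u-n+2)\,\Pi_{n-1}\,B_n(u-n+1).$$ Then $$A_n\langle\langle B_1,\dots,B_n\rangle\rangle=\operatorname{sdet}B(u)\,A_n .$$
   Context: Reflection algebra. Let $n=m+l$ with $m,l$ nonnegative integers, and $\varepsilon_i=1$ for $1\le i\le m$, $\varepsilon_i=-1$ for $m<i\le n$. Let $P:v\otimes w\mapsto w\otimes v$ on $\mathbb C^n\otimes\mathbb C^n$ and $R(u)=1-P/u$. The reflection algebra $\mathcal B(n,l)$ is the unital associative algebra over $\mathbb C$ with generators $b_{ij}^{(r)}$ ($i,j=1,\dots,n$, $r=0,1,2,\dots$), $b_{ij}^{(0)}=\delta_{ij}\varepsilon_i$, collected into series $b_i^j(u)=\sum_{r\ge0}b_{ij}^{(r)}u^{ -r}$ and the matrix $B(u)=\sum_{i,j}E_{ij}\otimes b_i^j(u)\in\operatorname{End}\mathbb C^n\otimes\mathcal B(n,l)[[u^{ -1}]]$, subject to the reflection equation $R(u-v)B_1(u)R(u+v)B_2(v)=B_2(v)R(u+v)B_1(u)R(u-v)$ and the unitary condition $B(u)B(-u)=1$. For a matrix $X=(x_{ij})$ over an associative algebra $A$,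 $X_s=\sum_{i,j}1\otimes\cdots\otimes E_{ij}\otimes\cdots\otimes1\otimes x_{ij}\in\operatorname{End}(\mathbb C^n)^{\otimes k}\otimes A$ with $E_{ij}$ in the $s$-th position; $P_{ij}$ and $R_{ij}(u)$ denote $P$ and $R(u)$ acting on the $i$-th and $j$-th copies of $\mathbb C^n$. Shifted series and rational functions of $u$ are expanded as power series in $u^{ -1}$. Sklyanin determinant. Abbreviate $R_{ij}:=R_{ij}(2u-i-j+2)$, and put $\langle B_1,\dots,B_n\rangle=B_1(u)(R_{12}\cdots R_{1n})B_2(u-1)(R_{23}\cdots R_{2n})\cdots B_n(u-n+1)$. Let $A_n(v_1\otimes\cdots\otimes v_n)=\sum_{\sigma\in S_n}(-1)^\sigma v_{\sigma(1)}\otimes\cdots\otimes v_{\sigma(n)}$ (no normalization). It is known that $A_n\langle B_1,\dots,B_n\rangle$ equals $A_n$ times a series in $u^{ -1}$ with coefficients in $\mathcal B(n,l)$; this series is $\operatorname{sdet}B(u)$, i.e. $A_n\langle B_1,\dots,B_n\rangle=\operatorname{sdet}B(u)\,A_n$. -}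

module Defs where

open import Algebra.Apartness.Bundles using (HeytingField; HeytingCommutativeRing)
open import Algebra.Bundles using (Ring; CommutativeRing)
open import Algebra.Bundles.Raw using (RawRing)
import Algebra.Definitions.RawSemiring as RawSemiringDefinitions
open import Data.Bool.Base using (if_then_else_)
open import Data.Fin.Base as Fin using (Fin; toℕ; splitAt)
import Data.Fin.Properties as Fin
open import Data.Fin.Permutation.Components using (transpose)
open import Data.List.Base as List
  using (List; []; _∷_; foldr; upTo; allFin; filter; cartesianProductWith)
open import Data.Nat.Base using (ℕ; zero; suc; _∸_) renaming (_+_ to _+ℕ_)
open import Data.Product.Base using (_,_; proj₁)
open import Data.Sum.Base using ([_,_]′)
open import Data.Vec.Base as Vec using (Vec; []; _∷_; lookup; tabulate; count; _[_]≔_)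
import Data.Vec.Properties as Vec
open import Data.Vec.Relation.Unary.AllPairs using (allPairs?)
open import Data.Vec.Relation.Unary.Unique.Propositional using (Unique)
open import Level using (Level; _⊔_)
open import Relation.Binary.Core using (Rel)
open import Relation.Binary.Definitions using (DecidableEquality)
open import Relation.Binary.PropositionalEquality.Core using (_≡_)
open import Relation.Nullary.Decidable.Core using (does; ¬?)
open import Relation.Unary using (Decidable)

private
  variable
    a c ℓ ℓ₁ ℓ₂ : Level

module ListFolds (R : RawRing c ℓ) where
  open RawRing R

  ∑ ∏ : {I : Set a} → List I → (I → Carrier) → Carrier
  ∑ is f = foldr (λ i → f i +_) 0# is
  ∏ is f = foldr (λ i → f i *_) 1# is

-- Formal power series in one central variable x; the series f stands for
-- ∑ᵣ (f r) xʳ.  Throughout, x = u⁻¹ (or v⁻¹).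
PowerSeries : RawRing c ℓ → RawRing c ℓ
PowerSeries R = record
  { Carrier = ℕ → Carrier
  ; _≈_     = λ f g → ∀ r → f r ≈ g r
  ; _+_     = λ f g r → f r + g r
  ; _*_     = λ f g r → ∑ (upTo (suc r)) λ s → f s * g (r ∸ s)
  ; -_      = λ f r → - f r
  ; 0#      = λ _ → 0#
  ; 1#      = λ { zero → 1# ; (suc _) → 0# }
  }
  where open RawRing R
        open ListFolds R

module PowerSeriesOps (R : RawRing c ℓ) where
  open RawRing R

  constant : Carrier → ℕ → Carrier
  constant x zero    = x
  constant x (suc _) = 0#

  indeterminate : ℕ → Carrier
  indeterminate 1 = 1#
  indeterminate _ = 0#

-- Square matrices whose rows and columns are indexed by the entries of a
-- duplicate-free exhaustive list.
Matrix : {I : Set a} → List I → DecidableEquality I → RawRing c ℓ → RawRing (a ⊔ c) (a ⊔ ℓ)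
Matrix {I = I} is _≟_ R = record
  { Carrier = I → I → Carrier
  ; _≈_     = λ X Y → ∀ i j → X i j ≈ Y i j
  ; _+_     = λ X Y i j → X i j + Y i j
  ; _*_     = λ X Y i j → ∑ is λ k → X i k * Y k j
  ; -_      = λ X i j → - X i j
  ; 0#      = λ _ _ → 0#
  ; 1#      = λ i j → if does (i ≟ j) then 1# else 0#
  }
  where open RawRing R
        open ListFolds R

module MatrixScalars {I : Set a} (R : RawRing c ℓ) where
  open RawRing R

  infixr 7 _•_
  _•_ : Carrier → (I → I → Carrier) → I → I → Carrier
  (x • X) i j = x * X i j

allVectors : (n k : ℕ) → List (Vec (Fin n) k)
allVectors n zero    = [] ∷ []
allVectors n (suc k) = cartesianProductWith _∷_ (allFin n) (allVectors n k)

_≟ᵛ_ : ∀ {n k} → DecidableEquality (Vec (Fin n) k)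
_≟ᵛ_ = Vec.≡-dec Fin._≟_

-- (End ℂⁿ)^{⊗k} ⊗ A.  The multi-index J = (j₁,…,jₖ) labels the basis vector
-- e_J = e_{j₁} ⊗ ⋯ ⊗ e_{jₖ}, and X e_J = ∑_I (X I J) e_I.
EndTensor : (n k : ℕ) → RawRing c ℓ → RawRing c ℓ
EndTensor n k = Matrix (allVectors n k) _≟ᵛ_

-- The symmetric group Sₙ in one-line notation: σ is the vector (σ(1),…,σ(n)).
unique? : ∀ {n k} → Decidable (Unique {A = Fin n} {n = k})
unique? = allPairs? λ x y → ¬? (x Fin.≟ y)

permutations : (n : ℕ) → List (Vec (Fin n) n)
permutations n = filter unique? (allVectors n n)

inversions : ∀ {n k} → Vec (Fin n) k → ℕ
inversions []       = 0
inversions (x ∷ xs) = count (Fin._<? x) xs +ℕ inversions xs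

module TensorOps (n k : ℕ) (R : RawRing c ℓ) where
  open RawRing R

  Tensor : Set c
  Tensor = RawRing.Carrier (EndTensor n k R)

  -- X_s: an entry vanishes unless the row and column multi-indices agree at
  -- every position other than s.
  at : Fin k → (Fin n → Fin n → Carrier) → Tensor
  at s X I J = if does (I ≟ᵛ (J [ s ]≔ lookup I s)) then X (lookup I s) (lookup J s) else 0#

  -- P_{ij} e_J = e_{J ∘ (i j)}
  P : Fin k → Fin k → Tensor
  P i j I J = if does (I ≟ᵛ tabulate (λ s → lookup J (transpose i j s))) then 1# else 0#

-- Aₙ e_J = ∑_σ (-1)^σ e_{J ∘ σ}, without the factor 1/n!
antisymmetrizer : (n : ℕ) (R : RawRing c ℓ) → RawRing.Carrier (EndTensor n n R)
antisymmetrizer n R I J =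
  ∑ (permutations n) λ σ →
    if does (I ≟ᵛ Vec.map (lookup J) σ) then (- 1#) ^ inversions σ else 0#
  where open RawRing R
        open RawSemiringDefinitions rawSemiring using (_^_)
        open ListFolds R

module _ (K : HeytingField c ℓ₁ ℓ₂) where
  open HeytingField K

  field-commutativeRing : CommutativeRing c ℓ₁
  field-commutativeRing = HeytingCommutativeRing.commutativeRing heytingCommutativeRing

  field-rawRing : RawRing c ℓ₁
  field-rawRing = CommutativeRing.rawRing field-commutativeRing

  open RawSemiringDefinitions (RawRing.rawSemiring field-rawRing) using (_×_)

  CharacteristicZero : Set ℓ₂
  CharacteristicZero = ∀ n → (suc n × 1#) # 0#

  half : CharacteristicZero → Carrier
  half char0 = proj₁ (#⇒invertible (char0 1))

-- The reflection algebra 𝓑(m + l, l) over K, as the quotient (setoid) of the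
-- free unital associative K-algebra on the symbols gen i j r = b_{ij}^{(r)}.
module ReflectionAlgebra (K : HeytingField c ℓ₁ ℓ₂) (m l : ℕ) where
  private module K = HeytingField K

  n : ℕ
  n = m +ℕ l

  infix  8 ⊖_
  infixl 7 _⊗_
  infixl 6 _⊕_

  data Term : Set c where
    gen     : Fin n → Fin n → ℕ → Term
    scalar  : K.Carrier → Term
    _⊕_ _⊗_ : Term → Term → Term
    ⊖_      : Term → Term

  termRawRing : RawRing c c
  termRawRing = record
    { Carrier = Term
    ; _≈_     = _≡_
    ; _+_     = _⊕_
    ; _*_     = _⊗_
    ; -_      = ⊖_
    ; 0#      = scalar K.0#
    ; 1#      = scalar K.1#
    }

  ε : Fin n → K.Carrier
  ε i = [ (λ _ → K.1#) , (λ _ → K.- K.1#) ]′ (splitAt m i)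

  B : Fin n → Fin n → ℕ → Term
  B i j r = gen i j r

  private
    module Unitarity where
      open RawSemiringDefinitions (RawRing.rawSemiring termRawRing) using (_^_)

      Mat : RawRing c c
      Mat = Matrix (allFin n) Fin._≟_ (PowerSeries termRawRing)

      open RawRing Mat

      B[-u] : Carrier
      B[-u] i j r = (⊖ scalar K.1#) ^ r ⊗ B i j r

      lhs rhs : Carrier
      lhs = B * B[-u]
      rhs = 1#

    -- Both sides of the reflection equation, multiplied by the central element
    -- (u-v)(u+v)/(uv)², which is not a zero divisor.  This makes every factor a
    -- power series in u⁻¹ and v⁻¹:
    --   (u-v)/(uv) · R(u-v) = v⁻¹ - u⁻¹ - u⁻¹v⁻¹P,
    --   (u+v)/(uv) · R(u+v) = v⁻¹ + u⁻¹ - u⁻¹v⁻¹P.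
    -- The outer series variable is u⁻¹ and the inner one is v⁻¹.
    module Reflection where
      V UV : RawRing c c
      V  = PowerSeries termRawRing
      UV = PowerSeries V

      open RawRing (EndTensor n 2 UV)
      open RawRing UV using () renaming (_*_ to _*ˢ_; _+_ to _+ˢ_; -_ to -ˢ_; Carrier to Series)
      open PowerSeriesOps using (constant; indeterminate)
      open MatrixScalars {I = Vec (Fin n) 2} UV using (_•_)
      open TensorOps n 2 UV using (at; P)

      u⁻¹ v⁻¹ : Series
      u⁻¹ = indeterminate V
      v⁻¹ = constant V (indeterminate termRawRing)

      P₁₂ R[u-v] R[u+v] B₁[u] B₂[v] : Carrier
      P₁₂    = P Fin.zero (Fin.suc Fin.zero)
      R[u-v] = (v⁻¹ +ˢ -ˢ u⁻¹) • 1# + - ((u⁻¹ *ˢ v⁻¹) • P₁₂)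
      R[u+v] = (v⁻¹ +ˢ u⁻¹) • 1# + - ((u⁻¹ *ˢ v⁻¹) • P₁₂)
      B₁[u]  = at Fin.zero λ i j r → constant termRawRing (B i j r)
      B₂[v]  = at (Fin.suc Fin.zero) λ i j → constant V (B i j)

      lhs rhs : Carrier
      lhs = R[u-v] * B₁[u] * R[u+v] * B₂[v]
      rhs = B₂[v] * R[u+v] * B₁[u] * R[u-v]

  infix 4 _≈_
  data _≈_ : Rel Term (c ⊔ ℓ₁) where
    ≈-refl  : ∀ {x} → x ≈ x
    ≈-sym   : ∀ {x y} → x ≈ y → y ≈ x
    ≈-trans : ∀ {x y z} → x ≈ y → y ≈ z → x ≈ z

    ⊕-cong : ∀ {x x′ y y′} → x ≈ x′ → y ≈ y′ → x ⊕ y ≈ x′ ⊕ y′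
    ⊗-cong : ∀ {x x′ y y′} → x ≈ x′ → y ≈ y′ → x ⊗ y ≈ x′ ⊗ y′
    ⊖-cong : ∀ {x x′} → x ≈ x′ → ⊖ x ≈ ⊖ x′

    ⊕-assoc     : ∀ x y z → (x ⊕ y) ⊕ z ≈ x ⊕ (y ⊕ z)
    ⊕-comm      : ∀ x y → x ⊕ y ≈ y ⊕ x
    ⊕-identityˡ : ∀ x → scalar K.0# ⊕ x ≈ x
    ⊖-inverseˡ  : ∀ x → ⊖ x ⊕ x ≈ scalar K.0#
    ⊗-assoc     : ∀ x y z → (x ⊗ y) ⊗ z ≈ x ⊗ (y ⊗ z)
    ⊗-identityˡ : ∀ x → scalar K.1# ⊗ x ≈ x
    ⊗-distribˡ  : ∀ x y z → x ⊗ (y ⊕ z) ≈ x ⊗ y ⊕ x ⊗ z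
    ⊗-distribʳ  : ∀ x y z → (y ⊕ z) ⊗ x ≈ y ⊗ x ⊕ z ⊗ x

    scalar-cong    : ∀ {p q} → p K.≈ q → scalar p ≈ scalar q
    scalar-⊕       : ∀ p q → scalar (p K.+ q) ≈ scalar p ⊕ scalar q
    scalar-⊗       : ∀ p q → scalar (p K.* q) ≈ scalar p ⊗ scalar q
    scalar-central : ∀ p x → scalar p ⊗ x ≈ x ⊗ scalar p

    initial    : ∀ i j → gen i j 0 ≈ (if does (i Fin.≟ j) then scalar (ε i) else scalar K.0#)
    unitary    : ∀ i j r → Unitarity.lhs i j r ≈ Unitarity.rhs i j r
    reflection : ∀ I J r s → Reflection.lhs I J r s ≈ Reflection.rhs I J r s

  ring : Ring c (c ⊔ ℓ₁)
  ring = record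
    { Carrier = Term
    ; _≈_     = _≈_
    ; _+_     = _⊕_
    ; _*_     = _⊗_
    ; -_      = ⊖_
    ; 0#      = scalar K.0#
    ; 1#      = scalar K.1#
    ; isRing  = record
      { +-isAbelianGroup = record
        { isGroup = record
          { isMonoid = record
            { isSemigroup = record
              { isMagma = record
                { isEquivalence = record { refl = ≈-refl ; sym = ≈-sym ; trans = ≈-trans }
                ; ∙-cong = ⊕-cong
                }
              ; assoc = ⊕-assoc
              }
            ; identity = ⊕-identityˡ
                       , λ x → ≈-trans (⊕-comm x _) (⊕-identityˡ x)
            }
          ; inverse = ⊖-inverseˡ
                    , λ x → ≈-trans (⊕-comm x _) (⊖-inverseˡ x)
          ; ⁻¹-cong = ⊖-cong
          }
        ; comm = ⊕-comm
        }
      ; *-cong = ⊗-cong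
      ; *-assoc = ⊗-assoc
      ; *-identity = ⊗-identityˡ
                   , λ x → ≈-trans (≈-sym (scalar-central K.1# x)) (⊗-identityˡ x)
      ; distrib = ⊗-distribˡ , ⊗-distribʳ
      }
    }

  rawRing : RawRing c (c ⊔ ℓ₁)
  rawRing = Ring.rawRing ring

module SklyaninDeterminant
  (K : HeytingField c ℓ₁ ℓ₂) (char0 : CharacteristicZero K) (m l : ℕ) where

  private
    module K  = HeytingField K
    module 𝓑  = ReflectionAlgebra K m l
    module K[[u⁻¹]] = RawRing (PowerSeries (field-rawRing K))
    open RawSemiringDefinitions (RawRing.rawSemiring (field-rawRing K))
      using (_×_) renaming (_^_ to _^ᴷ_)
    open RawSemiringDefinitions K[[u⁻¹]].rawSemiring using (_^_)

  open 𝓑 using (n; Term; scalar; B)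

  ℬ[[u⁻¹]] : RawRing c (c ⊔ ℓ₁)
  ℬ[[u⁻¹]] = PowerSeries 𝓑.rawRing

  Series : Set c
  Series = RawRing.Carrier ℬ[[u⁻¹]]

  -- The expansion 1/(αu - d) = ∑_{t≥0} α⁻¹ (d α⁻¹)ᵗ u⁻ᵗ⁻¹, given α⁻¹ and d.
  reciprocal : K.Carrier → ℕ → K[[u⁻¹]].Carrier
  reciprocal α⁻¹ d zero    = K.0#
  reciprocal α⁻¹ d (suc t) = α⁻¹ K.* ((d × K.1#) K.* α⁻¹) ^ᴷ t

  1/[u-_] 1/[2u-_] : ℕ → K[[u⁻¹]].Carrier
  1/[u- d ]  = reciprocal K.1# d
  1/[2u- d ] = reciprocal (half K char0) d

  -- f(u - d) = ∑ᵣ fᵣ (1/(u-d))ʳ; only the terms with r ≤ s contribute to u⁻ˢ.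
  shift : ℕ → Series → Series
  shift d f s = ∑ (upTo (suc s)) λ r → f r 𝓑.⊗ scalar ((1/[u- d ] ^ r) s)
    where open ListFolds 𝓑.rawRing

  open RawRing (EndTensor n n ℬ[[u⁻¹]]) public
    using () renaming (_≈_ to _≋_; _*_ to _·_)
  open RawRing (EndTensor n n ℬ[[u⁻¹]])
    using (1#; _+_; -_)
  open TensorOps n n ℬ[[u⁻¹]] using (Tensor; at; P)
  open ListFolds (EndTensor n n ℬ[[u⁻¹]]) using (∑; ∏)
  open MatrixScalars {I = Vec (Fin n) n} ℬ[[u⁻¹]] public using (_•_)

  -- The label in {1,…,n} of a tensor factor.  All truncated subtractions below
  -- are exact, as the labels and n are at least 1 wherever they occur.
  label : Fin n → ℕ
  label i = suc (toℕ i)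

  above : Fin n → List (Fin n)
  above i = filter (i Fin.<?_) (allFin n)

  -- B_k(u - k + 1)
  𝔹 : Fin n → Tensor
  𝔹 k = at k λ i j → shift (label k ∸ 1) (B i j)

  -- R_{ij} = R_{ij}(2u - i - j + 2)
  R : Fin n → Fin n → Tensor
  R i j = 1# + - ((λ r → scalar (1/[2u- (label i +ℕ label j) ∸ 2 ] r)) • P i j)

  Π : Fin n → Tensor
  Π k = 1# + - ((λ r → scalar (1/[2u- (label k +ℕ n) ∸ 2 ] r)) • ∑ (above k) (P k))

  -- X_1 Y_1 X_2 Y_2 ⋯ Y_{N-1} X_N for a list of N labels
  interleave : (X Y : Fin n → Tensor) → List (Fin n) → Tensor
  interleave X Y []               = 1#
  interleave X Y (k ∷ [])         = X k
  interleave X Y (k ∷ ks@(_ ∷ _)) = X k · (Y k · interleave X Y ks)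

  ⟨B⟩ ⟨⟨B⟩⟩ : Tensor
  ⟨B⟩   = interleave 𝔹 (λ i → ∏ (above i) (R i)) (allFin n)
  ⟨⟨B⟩⟩ = interleave 𝔹 Π (allFin n)

  A : Tensor
  A = antisymmetrizer n ℬ[[u⁻¹]]

  -- sdet B(u) is the series determined by this identity; it is unique because
  -- the entry of Aₙ at ((1,…,n), (1,…,n)) is 1.
  IsSdet : Series → Set (c ⊔ ℓ₁)
  IsSdet s = A · ⟨B⟩ ≋ s • A

{-# OPTIONS --safe #-}
-- Call Z antisymmetric over a set L of tensor factors if Z P_ij = -Z for all i ≠ j in
-- L.  If Z is antisymmetric over L and k ∉ L, then so is Z X for every X that
-- commutes with the P_ij, i, j ∈ L; this applies to B_k and to Π_k when
-- L = {k+1,…,n}.  Since P_kj P_ki = P_ji P_kj, moreover Z P_kj P_ki = -Z P_kj for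
-- such Z, and with q_d = 1/(2u-d) the relation q_{d+s} = q_d + s q_d q_{d+s}
-- yields Z R_{k,k+1} ⋯ R_{kn} = Z Π_k.  Starting from Z = Aₙ, replace the products
-- R_{k,k+1} ⋯ R_{kn} by Π_k for k = 1, 2, … in turn.
module Submission where

open import Defs
open import Algebra.Apartness.Bundles using (HeytingField)
open import Algebra.Bundles using (Ring; CommutativeRing)
open import Algebra.Bundles.Raw using (RawRing)
import Algebra.Definitions.RawSemiring as RawSemiringDefinitions
import Algebra.Properties.CommutativeSemigroup as CommutativeSemigroupProperties
import Algebra.Properties.Ring as RingProperties
import Algebra.Properties.Semiring.Mult as SemiringMult
import Algebra.Solver.Ring.NaturalCoefficients.Default as RingSolver
open import Data.Bool.Base using (Bool; true; false; if_then_else_)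
open import Data.Fin.Base as Fin using (Fin; zero; suc; toℕ)
open import Data.Fin.Permutation.Components using (transpose; transpose-inverse)
import Data.Fin.Properties as Fin
open import Data.List.Base as List
  using (List; []; _∷_; map; length; foldr; upTo; allFin; filter)
import Data.List.Properties as List
open import Data.List.Membership.Propositional using (_∈_; _∉_)
open import Data.List.Membership.Propositional.Properties
  using (∈-map⁺; ∈-map⁻; ∈-allFin; ∈-cartesianProductWith⁺; ∈-filter⁺; ∈-filter⁻)
open import Data.List.Membership.Propositional.Properties.WithK using (unique∧set⇒bag)
open import Data.List.Relation.Binary.BagAndSetEquality using (∼bag⇒↭)
open import Data.List.Relation.Binary.Permutation.Propositional using (_↭_; ↭⇒↭ₛ)
import Data.List.Relation.Binary.Permutation.Setoid.Properties as PermSetoid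
open import Data.List.Relation.Unary.All as All using (All; []; _∷_)
import Data.List.Relation.Unary.All.Properties as All
open import Data.List.Relation.Unary.Any using (here; there)
open import Data.List.Relation.Unary.AllPairs using ([]; _∷_)
open import Data.List.Relation.Unary.Unique.Propositional using (Unique)
import Data.List.Relation.Unary.Unique.Propositional.Properties as Unique
open import Data.Nat.Base as ℕ using (ℕ; zero; suc; _∸_; z≤n; s≤s) renaming (_+_ to _+ℕ_; _*_ to _*ℕ_)
import Data.Nat.Properties as ℕ
open import Data.Product.Base using (_,_; proj₂; ∃)
open import Data.Sum.Base using (_⊎_; inj₁; inj₂)
open import Data.Vec.Base as Vec using (Vec; []; _∷_; lookup; tabulate; count; _[_]≔_)
import Data.Vec.Properties as Vec
open import Data.Vec.Relation.Unary.All as VecAll using ([]; _∷_)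
import Data.Vec.Relation.Unary.All.Properties as VecAll
open import Data.Vec.Relation.Unary.AllPairs using ([]; _∷_)
import Data.Vec.Relation.Unary.Unique.Propositional as Vec
import Data.Vec.Relation.Unary.Unique.Propositional.Properties as VecUnique
open import Function.Base using (id; _∘_)
open import Function.Bundles using (mk⇔)
open import Level using (Level)
open import Relation.Binary.Definitions using (DecidableEquality; Tri; tri<; tri≈; tri>)
open import Relation.Binary.PropositionalEquality as ≡ using (_≡_; _≢_; _≗_; ≢-sym)
open import Relation.Nullary using (¬_; Dec; yes; no; does; contradiction)
open import Relation.Nullary.Decidable using (does-⇔; dec-true; dec-false)

-- The order of the replacements is forced. The product R_{k,k+1} ⋯ R_{kn} has parameters that vary
-- from factor to factor, hence no symmetry in the later labels, whereas Π_k sums over all of them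
-- with one coefficient. Antisymmetry over the labels beyond k is therefore carried past position k
-- only once the product has become Π_k. That a single coefficient results is due to the spacing of
-- the parameters: when R_{kj} is expanded, each of the n - j transpositions P_{ki} with i > j
-- contributes the same multiple of Z P_{kj}, and the denominators 2u-k-j+2 and 2u-k-n+2 differ by
-- exactly n - j. Since the entries of B(u) do not commute, scalar series are carried as central
-- elements of the tensor algebra. The straightening then takes place in an arbitrary ring with
-- elements `P i j` that obey the conjugation rule of transpositions.

private
  variable
    a c ℓ ℓ₁ ℓ₂ : Level

-- Reindexing and finite sums in a ring

-- As `π` is its own inverse, `map π is` is again duplicate-free, and closedness gives both
-- inclusions; duplicate-free lists with the same members are permutations of each other.
involution-↭ : {I : Set a} {is : List I} {π : I → I} → Unique is →
               (∀ i → π (π i) ≡ i) → (∀ {i} → i ∈ is → π i ∈ is) → is ↭ map π is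
involution-↭ {is = is} {π} u inv closed = ∼bag⇒↭ (unique∧set⇒bag u
  (Unique.map⁺ (λ {x} {y} eq → ≡.trans (≡.sym (inv x)) (≡.trans (≡.cong π eq) (inv y))) u)
  (mk⇔ (λ i∈ → ≡.subst (_∈ map π is) (inv _) (∈-map⁺ π (closed i∈)))
       (λ i∈ → let j , j∈ , eq = ∈-map⁻ π i∈ in ≡.subst (_∈ is) (≡.sym eq) (closed j∈))))

module FoldProperties (R : Ring c ℓ) where
  open Ring R
  open ListFolds rawRing
  open import Relation.Binary.Reasoning.Setoid setoid
  open CommutativeSemigroupProperties +-commutativeSemigroup using (interchange)

  module _ {I : Set a} where

    ∑-cong-All : {is : List I} {f g : I → Carrier} →
                 All (λ i → f i ≈ g i) is → ∑ is f ≈ ∑ is g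
    ∑-cong-All []         = refl
    ∑-cong-All (eq ∷ eqs) = +-cong eq (∑-cong-All eqs)

    ∑-cong : (is : List I) {f g : I → Carrier} → (∀ i → f i ≈ g i) → ∑ is f ≈ ∑ is g
    ∑-cong is eq = ∑-cong-All (All.universal eq is)

    ∑-zero : (is : List I) → ∑ is (λ _ → 0#) ≈ 0#
    ∑-zero []       = refl
    ∑-zero (i ∷ is) = trans (+-identityˡ _) (∑-zero is)

    ∑-+ : (is : List I) (f g : I → Carrier) → ∑ is (λ i → f i + g i) ≈ ∑ is f + ∑ is g
    ∑-+ []       f g = sym (+-identityˡ 0#)
    ∑-+ (i ∷ is) f g = trans (+-congˡ (∑-+ is f g)) (interchange _ _ _ _)

    ∑-distribˡ : (is : List I) (x : Carrier) (f : I → Carrier) → x * ∑ is f ≈ ∑ is (λ i → x * f i)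
    ∑-distribˡ []       x f = zeroʳ x
    ∑-distribˡ (i ∷ is) x f = trans (distribˡ _ _ _) (+-congˡ (∑-distribˡ is x f))

    ∑-distribʳ : (is : List I) (x : Carrier) (f : I → Carrier) → ∑ is f * x ≈ ∑ is (λ i → f i * x)
    ∑-distribʳ []       x f = zeroˡ x
    ∑-distribʳ (i ∷ is) x f = trans (distribʳ _ _ _) (+-congˡ (∑-distribʳ is x f))

    ∑-const : (is : List I) (x : Carrier) →
              ∑ is (λ _ → x) ≈ RawSemiringDefinitions._×_ (RawRing.rawSemiring rawRing) (length is) x
    ∑-const []       x = refl
    ∑-const (i ∷ is) x = +-congˡ (∑-const is x)

    ∑-↭ : {is js : List I} (f : I → Carrier) → is ↭ js → ∑ is f ≈ ∑ js f
    ∑-↭ {is} {js} f is↭js = begin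
      ∑ is f                      ≡⟨ List.foldr-map _+_ f 0# is ⟨
      foldr _+_ 0# (map f is)     ≈⟨ PermSetoid.foldr-commMonoid setoid +-isCommutativeMonoid
                                       (PermSetoid.map⁺ (≡.setoid I) setoid reflexive′ (↭⇒↭ₛ is↭js)) ⟩
      foldr _+_ 0# (map f js)     ≡⟨ List.foldr-map _+_ f 0# js ⟩
      ∑ js f                      ∎
      where
      reflexive′ : ∀ {x y} → x ≡ y → f x ≈ f y
      reflexive′ ≡.refl = refl

    -- Serves two reindexings: of Sₙ under left multiplication by a transposition, and of a set of
    -- tensor factors under a transposition inside it.
    ∑-involution : {is : List I} {π : I → I} (f : I → Carrier) → Unique is →
                   (∀ i → π (π i) ≡ i) → (∀ {i} → i ∈ is → π i ∈ is) →
                   ∑ is (f ∘ π) ≈ ∑ is f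
    ∑-involution {is} {π} f u inv closed = begin
      ∑ is (f ∘ π)     ≡⟨ List.foldr-map (λ i → f i +_) π 0# is ⟨
      ∑ (map π is) f   ≈⟨ ∑-↭ f (involution-↭ u inv closed) ⟨
      ∑ is f           ∎

    ∑-single : {is : List I} {i : I} (f : I → Carrier) → Unique is → i ∈ is →
               (∀ j → j ≢ i → f j ≈ 0#) → ∑ is f ≈ f i
    ∑-single {i ∷ is} f (i∉ ∷ u) (here ≡.refl) f≈0 = begin
      f i + ∑ is f           ≈⟨ +-congˡ (∑-cong-All (All.map (λ i≢j → f≈0 _ (≢-sym i≢j)) i∉)) ⟩
      f i + ∑ is (λ _ → 0#)  ≈⟨ +-congˡ (∑-zero is) ⟩
      f i + 0#               ≈⟨ +-identityʳ _ ⟩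
      f i                    ∎
    ∑-single {j ∷ is} {i} f (j∉ ∷ u) (there i∈) f≈0 = begin
      f j + ∑ is f  ≈⟨ +-cong (f≈0 j (All.lookup j∉ i∈)) (∑-single f u i∈ f≈0) ⟩
      0# + f i      ≈⟨ +-identityˡ _ ⟩
      f i           ∎

    module _ {is : List I} {i : I} {p : I → Bool} (f : I → Carrier) (u : Unique is) (i∈ : i ∈ is)
             (pi : p i ≡ true) (pj : ∀ j → j ≢ i → p j ≡ false) where

      -- The indicator is any Boolean function that holds at `i` alone, so that the unit matrix and
      -- the permutation matrices `P` are both covered.
      ∑-δˡ : ∑ is (λ k → (if p k then 1# else 0#) * f k) ≈ f i
      ∑-δˡ = trans (∑-single _ u i∈ (λ j j≢i → trans (*-congʳ (reflexive (≡.cong (if_then 1# else 0#) (pj j j≢i)))) (zeroˡ _)))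
                   (trans (*-congʳ (reflexive (≡.cong (if_then 1# else 0#) pi))) (*-identityˡ _))

      ∑-δʳ : ∑ is (λ k → f k * (if p k then 1# else 0#)) ≈ f i
      ∑-δʳ = trans (∑-single _ u i∈ (λ j j≢i → trans (*-congˡ (reflexive (≡.cong (if_then 1# else 0#) (pj j j≢i)))) (zeroʳ _)))
                   (trans (*-congˡ (reflexive (≡.cong (if_then 1# else 0#) pi))) (*-identityʳ _))

  ∑-swap : {I : Set a} {J : Set a} (is : List I) (js : List J) (f : I → J → Carrier) →
           ∑ is (λ i → ∑ js (f i)) ≈ ∑ js (λ j → ∑ is (λ i → f i j))
  ∑-swap []       js f = sym (∑-zero js)
  ∑-swap (i ∷ is) js f = trans (+-congˡ (∑-swap is js f)) (sym (∑-+ js (f i) _))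

  ∑-upTo-suc : (k : ℕ) (f : ℕ → Carrier) → ∑ (upTo (suc k)) f ≡ f 0 + ∑ (upTo k) (f ∘ suc)
  ∑-upTo-suc k f = ≡.cong (f 0 +_) (≡.trans
    (≡.cong (λ is → ∑ is f) (≡.sym (List.map-upTo suc k)))
    (List.foldr-map (λ i → f i +_) suc 0# (upTo k)))

-- The ring of formal power series over a possibly noncommutative ring

module PowerSeriesRing (R : Ring c ℓ) where
  open Ring R
  open ListFolds rawRing
  open FoldProperties R
  open import Relation.Binary.Reasoning.Setoid setoid
  open RawRing (PowerSeries rawRing)
    using () renaming (Carrier to Series; _*_ to _*ˢ_; _+_ to _+ˢ_; _≈_ to _≈ˢ_; 1# to 1ˢ)

  -- Here `f ∘ suc` is the series (f - f 0)/x. With this recursion the ring laws follow by induction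
  -- on the degree, without rearranging double sums.
  *ˢ-suc : ∀ (f g : Series) r → (f *ˢ g) (suc r) ≈ f 0 * g (suc r) + ((f ∘ suc) *ˢ g) r
  *ˢ-suc f g r = reflexive (∑-upTo-suc (suc r) (λ s → f s * g (suc r ∸ s)))

  *ˢ-zero : ∀ (f g : Series) → (f *ˢ g) 0 ≈ f 0 * g 0
  *ˢ-zero f g = +-identityʳ _

  *ˢ-cong : ∀ {f f′ g g′} → f ≈ˢ f′ → g ≈ˢ g′ → (f *ˢ g) ≈ˢ (f′ *ˢ g′)
  *ˢ-cong f≈ g≈ r = ∑-cong (upTo (suc r)) (λ s → *-cong (f≈ s) (g≈ (r ∸ s)))

  *ˢ-distribˡ : ∀ f g h → (f *ˢ (g +ˢ h)) ≈ˢ ((f *ˢ g) +ˢ (f *ˢ h))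
  *ˢ-distribˡ f g h r = trans (∑-cong (upTo (suc r)) (λ s → distribˡ _ _ _)) (∑-+ (upTo (suc r)) _ _)

  *ˢ-distribʳ : ∀ f g h → ((g +ˢ h) *ˢ f) ≈ˢ ((g *ˢ f) +ˢ (h *ˢ f))
  *ˢ-distribʳ f g h r = trans (∑-cong (upTo (suc r)) (λ s → distribʳ _ _ _)) (∑-+ (upTo (suc r)) _ _)

  *ˢ-scaleˡ : ∀ x (f g : Series) → ((λ s → x * f s) *ˢ g) ≈ˢ (λ r → x * (f *ˢ g) r)
  *ˢ-scaleˡ x f g r = trans (∑-cong (upTo (suc r)) (λ s → *-assoc _ _ _)) (sym (∑-distribˡ (upTo (suc r)) x _))

  *ˢ-assoc : ∀ f g h → ((f *ˢ g) *ˢ h) ≈ˢ (f *ˢ (g *ˢ h))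
  *ˢ-assoc f g h zero = begin
    ((f *ˢ g) *ˢ h) 0      ≈⟨ *ˢ-zero (f *ˢ g) h ⟩
    (f *ˢ g) 0 * h 0       ≈⟨ *-congʳ (*ˢ-zero f g) ⟩
    f 0 * g 0 * h 0        ≈⟨ *-assoc _ _ _ ⟩
    f 0 * (g 0 * h 0)      ≈⟨ *-congˡ (*ˢ-zero g h) ⟨
    f 0 * (g *ˢ h) 0       ≈⟨ *ˢ-zero f (g *ˢ h) ⟨
    (f *ˢ (g *ˢ h)) 0      ∎
  *ˢ-assoc f g h (suc r) = begin
    ((f *ˢ g) *ˢ h) (suc r)
      ≈⟨ *ˢ-suc (f *ˢ g) h r ⟩
    (f *ˢ g) 0 * h (suc r) + (((f *ˢ g) ∘ suc) *ˢ h) r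
      ≈⟨ +-cong (*-congʳ (*ˢ-zero f g)) (*ˢ-cong {g = h} (*ˢ-suc f g) (λ _ → refl) r) ⟩
    f 0 * g 0 * h (suc r) + (((λ s → f 0 * g (suc s)) +ˢ ((f ∘ suc) *ˢ g)) *ˢ h) r
      ≈⟨ +-congˡ (*ˢ-distribʳ h (λ s → f 0 * g (suc s)) ((f ∘ suc) *ˢ g) r) ⟩
    f 0 * g 0 * h (suc r) + (((λ s → f 0 * g (suc s)) *ˢ h) r + (((f ∘ suc) *ˢ g) *ˢ h) r)
      ≈⟨ +-cong (*-assoc _ _ _) (+-cong (*ˢ-scaleˡ (f 0) (g ∘ suc) h r) (*ˢ-assoc (f ∘ suc) g h r)) ⟩
    f 0 * (g 0 * h (suc r)) + (f 0 * ((g ∘ suc) *ˢ h) r + ((f ∘ suc) *ˢ (g *ˢ h)) r)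
      ≈⟨ +-assoc _ _ _ ⟨
    f 0 * (g 0 * h (suc r)) + f 0 * ((g ∘ suc) *ˢ h) r + ((f ∘ suc) *ˢ (g *ˢ h)) r
      ≈⟨ +-congʳ (distribˡ _ _ _) ⟨
    f 0 * (g 0 * h (suc r) + ((g ∘ suc) *ˢ h) r) + ((f ∘ suc) *ˢ (g *ˢ h)) r
      ≈⟨ +-congʳ (*-congˡ (*ˢ-suc g h r)) ⟨
    f 0 * (g *ˢ h) (suc r) + ((f ∘ suc) *ˢ (g *ˢ h)) r
      ≈⟨ *ˢ-suc f (g *ˢ h) r ⟨
    (f *ˢ (g *ˢ h)) (suc r) ∎

  *ˢ-zeroˡ : ∀ g → ((λ _ → 0#) *ˢ g) ≈ˢ (λ _ → 0#)
  *ˢ-zeroˡ g r = trans (∑-cong (upTo (suc r)) (λ s → zeroˡ _)) (∑-zero (upTo (suc r)))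

  *ˢ-identityˡ : ∀ f → (1ˢ *ˢ f) ≈ˢ f
  *ˢ-identityˡ f zero    = trans (*ˢ-zero 1ˢ f) (*-identityˡ _)
  *ˢ-identityˡ f (suc r) = begin
    (1ˢ *ˢ f) (suc r)                          ≈⟨ *ˢ-suc 1ˢ f r ⟩
    1# * f (suc r) + ((λ _ → 0#) *ˢ f) r       ≈⟨ +-cong (*-identityˡ _) (*ˢ-zeroˡ f r) ⟩
    f (suc r) + 0#                             ≈⟨ +-identityʳ _ ⟩
    f (suc r)                                  ∎

  *ˢ-identityʳ : ∀ f → (f *ˢ 1ˢ) ≈ˢ f
  *ˢ-identityʳ f zero    = trans (*ˢ-zero f 1ˢ) (*-identityʳ _)
  *ˢ-identityʳ f (suc r) = begin
    (f *ˢ 1ˢ) (suc r)                   ≈⟨ *ˢ-suc f 1ˢ r ⟩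
    f 0 * 0# + ((f ∘ suc) *ˢ 1ˢ) r      ≈⟨ +-cong (zeroʳ _) (*ˢ-identityʳ (f ∘ suc) r) ⟩
    0# + f (suc r)                      ≈⟨ +-identityˡ _ ⟩
    f (suc r)                           ∎

  -- The mirror image of `*ˢ-suc`: to compare f g with g f, the leading coefficient of the same
  -- series f has to be removed on opposite sides.
  *ˢ-sucʳ : ∀ (f g : Series) r → (f *ˢ g) (suc r) ≈ (f *ˢ (g ∘ suc)) r + f (suc r) * g 0
  *ˢ-sucʳ f g zero = begin
    (f *ˢ g) 1                            ≈⟨ *ˢ-suc f g 0 ⟩
    f 0 * g 1 + ((f ∘ suc) *ˢ g) 0        ≈⟨ +-cong (sym (*ˢ-zero f (g ∘ suc))) (*ˢ-zero (f ∘ suc) g) ⟩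
    (f *ˢ (g ∘ suc)) 0 + f 1 * g 0        ∎
  *ˢ-sucʳ f g (suc r) = begin
    (f *ˢ g) (suc (suc r))
      ≈⟨ *ˢ-suc f g (suc r) ⟩
    f 0 * g (suc (suc r)) + ((f ∘ suc) *ˢ g) (suc r)
      ≈⟨ +-congˡ (*ˢ-sucʳ (f ∘ suc) g r) ⟩
    f 0 * g (suc (suc r)) + (((f ∘ suc) *ˢ (g ∘ suc)) r + f (suc (suc r)) * g 0)
      ≈⟨ +-assoc _ _ _ ⟨
    f 0 * g (suc (suc r)) + ((f ∘ suc) *ˢ (g ∘ suc)) r + f (suc (suc r)) * g 0
      ≈⟨ +-congʳ (*ˢ-suc f (g ∘ suc) r) ⟨
    (f *ˢ (g ∘ suc)) (suc r) + f (suc (suc r)) * g 0 ∎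

  *ˢ-central : ∀ (f : Series) → (∀ r x → f r * x ≈ x * f r) → ∀ g → (f *ˢ g) ≈ˢ (g *ˢ f)
  *ˢ-central f central g zero    =
    trans (*ˢ-zero f g) (trans (central 0 (g 0)) (sym (*ˢ-zero g f)))
  *ˢ-central f central g (suc r) = begin
    (f *ˢ g) (suc r)                          ≈⟨ *ˢ-suc f g r ⟩
    f 0 * g (suc r) + ((f ∘ suc) *ˢ g) r      ≈⟨ +-cong (central 0 _) (*ˢ-central (f ∘ suc) (central ∘ suc) g r) ⟩
    g (suc r) * f 0 + (g *ˢ (f ∘ suc)) r      ≈⟨ +-comm _ _ ⟩
    (g *ˢ (f ∘ suc)) r + g (suc r) * f 0      ≈⟨ *ˢ-sucʳ g f r ⟨
    (g *ˢ f) (suc r)                          ∎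

powerSeriesRing : Ring c ℓ → Ring c ℓ
powerSeriesRing R = record
  { isRing = record
    { +-isAbelianGroup = record
      { isGroup = record
        { isMonoid = record
          { isSemigroup = record
            { isMagma = record
              { isEquivalence = record
                { refl = λ _ → refl ; sym = λ p r → sym (p r) ; trans = λ p q r → trans (p r) (q r) }
              ; ∙-cong = λ p q r → +-cong (p r) (q r)
              }
            ; assoc = λ f g h r → +-assoc (f r) (g r) (h r)
            }
          ; identity = (λ f r → +-identityˡ (f r)) , (λ f r → +-identityʳ (f r))
          }
        ; inverse = (λ f r → -‿inverseˡ (f r)) , (λ f r → -‿inverseʳ (f r))
        ; ⁻¹-cong = λ p r → -‿cong (p r)
        }
      ; comm = λ f g r → +-comm (f r) (g r)
      }
    ; *-cong = *ˢ-cong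
    ; *-assoc = *ˢ-assoc
    ; *-identity = *ˢ-identityˡ , *ˢ-identityʳ
    ; distrib = *ˢ-distribˡ , *ˢ-distribʳ
    }
  }
  where
  open Ring R
  open PowerSeriesRing R

-- Matrix rings and scalar matrices

module MatrixRing {I : Set a} {is : List I} (_≟_ : DecidableEquality I)
                  (is-unique : Unique is) (is-complete : ∀ i → i ∈ is) (R : Ring c ℓ) where
  open Ring R
  open FoldProperties R
  open ListFolds rawRing
  open import Relation.Binary.Reasoning.Setoid setoid

  private
    raw : RawRing _ _
    raw = Matrix is _≟_ rawRing

    open RawRing raw
      using () renaming (Carrier to Mat; _*_ to _*ᴹ_; _≈_ to _≈ᴹ_; 1# to 1ᴹ)

  *ᴹ-assoc : ∀ X Y Z → ((X *ᴹ Y) *ᴹ Z) ≈ᴹ (X *ᴹ (Y *ᴹ Z))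
  *ᴹ-assoc X Y Z i j = begin
    ∑ is (λ k → ∑ is (λ h → X i h * Y h k) * Z k j)   ≈⟨ ∑-cong is (λ k → ∑-distribʳ is _ _) ⟩
    ∑ is (λ k → ∑ is (λ h → X i h * Y h k * Z k j))   ≈⟨ ∑-swap is is _ ⟩
    ∑ is (λ h → ∑ is (λ k → X i h * Y h k * Z k j))   ≈⟨ ∑-cong is (λ h → ∑-cong is (λ k → *-assoc _ _ _)) ⟩
    ∑ is (λ h → ∑ is (λ k → X i h * (Y h k * Z k j))) ≈⟨ ∑-cong is (λ h → ∑-distribˡ is _ _) ⟨
    ∑ is (λ h → X i h * ∑ is (λ k → Y h k * Z k j))   ∎

  *ᴹ-identityˡ : ∀ X → (1ᴹ *ᴹ X) ≈ᴹ X
  *ᴹ-identityˡ X i j = ∑-δˡ (λ k → X k j) is-unique (is-complete i)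
    (dec-true (i ≟ i) ≡.refl) (λ k k≢i → dec-false (i ≟ k) (≢-sym k≢i))

  *ᴹ-identityʳ : ∀ X → (X *ᴹ 1ᴹ) ≈ᴹ X
  *ᴹ-identityʳ X i j = ∑-δʳ (λ k → X i k) is-unique (is-complete j)
    (dec-true (j ≟ j) ≡.refl) (λ k k≢j → dec-false (k ≟ j) k≢j)

  matrixRing : Ring _ _
  matrixRing = record
    { RawRing raw
    ; isRing = record
      { +-isAbelianGroup = record
        { isGroup = record
          { isMonoid = record
            { isSemigroup = record
              { isMagma = record
                { isEquivalence = record
                  { refl = λ _ _ → refl
                  ; sym = λ p i j → sym (p i j)
                  ; trans = λ p q i j → trans (p i j) (q i j) }
                ; ∙-cong = λ p q i j → +-cong (p i j) (q i j)
                }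
              ; assoc = λ X Y Z i j → +-assoc (X i j) (Y i j) (Z i j)
              }
            ; identity = (λ X i j → +-identityˡ (X i j)) , (λ X i j → +-identityʳ (X i j))
            }
          ; inverse = (λ X i j → -‿inverseˡ (X i j)) , (λ X i j → -‿inverseʳ (X i j))
          ; ⁻¹-cong = λ p i j → -‿cong (p i j)
          }
        ; comm = λ X Y i j → +-comm (X i j) (Y i j)
        }
      ; *-cong = λ p q i j → ∑-cong is (λ k → *-cong (p i k) (q k j))
      ; *-assoc = *ᴹ-assoc
      ; *-identity = *ᴹ-identityˡ , *ᴹ-identityʳ
      ; distrib =
          (λ X Y Z i j → trans (∑-cong is (λ k → distribˡ _ _ _)) (∑-+ is _ _))
        , (λ X Y Z i j → trans (∑-cong is (λ k → distribʳ _ _ _)) (∑-+ is _ _))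
      }
    }

  open MatrixScalars {I = I} rawRing using (_•_)

  module _ {x : Carrier} (central : ∀ y → x * y ≈ y * x) where

    -- Together with `•1-*ʳ` this makes a central scalar into a central element of the matrix ring,
    -- so that later arguments need only ring multiplication.
    •1-*ˡ : ∀ X → ((x • 1ᴹ) *ᴹ X) ≈ᴹ (x • X)
    •1-*ˡ X i j = begin
      ∑ is (λ k → x * 1ᴹ i k * X k j)     ≈⟨ ∑-cong is (λ k → *-assoc _ _ _) ⟩
      ∑ is (λ k → x * (1ᴹ i k * X k j))   ≈⟨ ∑-distribˡ is _ _ ⟨
      x * (1ᴹ *ᴹ X) i j                   ≈⟨ *-congˡ (*ᴹ-identityˡ X i j) ⟩
      x * X i j                           ∎

    •1-*ʳ : ∀ X → (X *ᴹ (x • 1ᴹ)) ≈ᴹ (x • X)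
    •1-*ʳ X i j = begin
      ∑ is (λ k → X i k * (x * 1ᴹ k j))   ≈⟨ ∑-cong is (λ k → *-assoc _ _ _) ⟨
      ∑ is (λ k → X i k * x * 1ᴹ k j)     ≈⟨ ∑-cong is (λ k → *-congʳ (central (X i k))) ⟨
      ∑ is (λ k → x * X i k * 1ᴹ k j)     ≈⟨ ∑-cong is (λ k → *-assoc _ _ _) ⟩
      ∑ is (λ k → x * (X i k * 1ᴹ k j))   ≈⟨ ∑-distribˡ is _ _ ⟨
      x * (X *ᴹ 1ᴹ) i j                   ≈⟨ *-congˡ (*ᴹ-identityʳ X i j) ⟩
      x * X i j                           ∎

-- The list of multi-indices

allVectors-unique : ∀ n k → Unique (allVectors n k)
allVectors-unique n zero    = [] ∷ []
allVectors-unique n (suc k) =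
  Unique.cartesianProductWith⁺ _∷_ Vec.∷-injective (Unique.allFin⁺ n) (allVectors-unique n k)

allVectors-complete : ∀ {n k} (I : Vec (Fin n) k) → I ∈ allVectors n k
allVectors-complete []      = here ≡.refl
allVectors-complete (i ∷ I) = ∈-cartesianProductWith⁺ _∷_ (∈-allFin i) (allVectors-complete I)

-- Transpositions

transpose-matchˡ : ∀ {n} (i j : Fin n) → transpose i j i ≡ j
transpose-matchˡ i j rewrite dec-true (i Fin.≟ i) ≡.refl = ≡.refl

transpose-matchʳ : ∀ {n} (i j : Fin n) → transpose i j j ≡ i
transpose-matchʳ i j with j Fin.≟ i
... | yes j≡i = j≡i
... | no  _   rewrite dec-true (j Fin.≟ j) ≡.refl = ≡.refl

transpose-mismatch : ∀ {n} {i j k : Fin n} → k ≢ i → k ≢ j → transpose i j k ≡ k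
transpose-mismatch {i = i} {j} {k} k≢i k≢j
  rewrite dec-false (k Fin.≟ i) k≢i | dec-false (k Fin.≟ j) k≢j = ≡.refl

transpose-comm : ∀ {n} (i j : Fin n) → transpose i j ≗ transpose j i
transpose-comm i j k = go (k Fin.≟ i) (k Fin.≟ j)
  where
  go : Dec (k ≡ i) → Dec (k ≡ j) → transpose i j k ≡ transpose j i k
  go (yes ≡.refl) _            = ≡.trans (transpose-matchˡ k j) (≡.sym (transpose-matchʳ j k))
  go (no _)       (yes ≡.refl) = ≡.trans (transpose-matchʳ i k) (≡.sym (transpose-matchˡ k i))
  go (no k≢i)     (no k≢j)     =
    ≡.trans (transpose-mismatch k≢i k≢j) (≡.sym (transpose-mismatch k≢j k≢i))

transpose-involutive : ∀ {n} (i j k : Fin n) → transpose i j (transpose i j k) ≡ k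
transpose-involutive i j k =
  ≡.trans (≡.cong (transpose i j) (transpose-comm i j k)) (transpose-inverse i j)

transpose-injective : ∀ {n} (i j : Fin n) {k l} → transpose i j k ≡ transpose i j l → k ≡ l
transpose-injective i j {k} {l} eq = ≡.trans (≡.sym (transpose-involutive i j k))
  (≡.trans (≡.cong (transpose i j) eq) (transpose-involutive i j l))

transpose-conjugate : ∀ {n} (π : Fin n → Fin n) → (∀ {k l} → π k ≡ π l → k ≡ l) →
                      ∀ i j → π ∘ transpose i j ≗ transpose (π i) (π j) ∘ π
transpose-conjugate π π-inj i j k with k Fin.≟ i
... | yes ≡.refl = ≡.sym (transpose-matchˡ (π k) (π j))
... | no  k≢i with k Fin.≟ j
...   | yes ≡.refl = ≡.sym (transpose-matchʳ (π i) (π k))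
...   | no  k≢j    = ≡.sym (transpose-mismatch (k≢i ∘ π-inj) (k≢j ∘ π-inj))

transpose-∈ : ∀ {n} {L : List (Fin n)} {i j} → i ∈ L → j ∈ L → ∀ {k} → k ∈ L → transpose i j k ∈ L
transpose-∈ {i = i} {j} i∈ j∈ {k} k∈ with k Fin.≟ i
... | yes _ = j∈
... | no  _ with k Fin.≟ j
...   | yes _ = i∈
...   | no  _ = k∈

-- Composing multi-indices with maps of positions

infixl 9 _⟪_⟫
-- This is J ∘ φ, a right action; for a transposition φ it unfolds to the very expression in the
-- definition of `P`.
_⟪_⟫ : ∀ {A : Set a} {k} → Vec A k → (Fin k → Fin k) → Vec A k
J ⟪ φ ⟫ = tabulate (λ s → lookup J (φ s))

lookup-extensional : {A : Set a} {k : ℕ} {I J : Vec A k} → lookup I ≗ lookup J → I ≡ J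
lookup-extensional {I = I} {J} eq =
  ≡.trans (≡.sym (Vec.tabulate∘lookup I)) (≡.trans (Vec.tabulate-cong eq) (Vec.tabulate∘lookup J))

module _ {A : Set a} {k : ℕ} where

  lookup-⟪⟫ : ∀ (J : Vec A k) φ s → lookup (J ⟪ φ ⟫) s ≡ lookup J (φ s)
  lookup-⟪⟫ J φ s = Vec.lookup∘tabulate _ s

  ⟪⟫-∘ : ∀ (J : Vec A k) φ ψ → J ⟪ φ ⟫ ⟪ ψ ⟫ ≡ J ⟪ φ ∘ ψ ⟫
  ⟪⟫-∘ J φ ψ = Vec.tabulate-cong (λ s → lookup-⟪⟫ J φ (ψ s))

  ⟪⟫-cong : ∀ (J : Vec A k) {φ ψ} → φ ≗ ψ → J ⟪ φ ⟫ ≡ J ⟪ ψ ⟫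
  ⟪⟫-cong J eq = Vec.tabulate-cong (λ s → ≡.cong (lookup J) (eq s))

  ⟪⟫-involutive : ∀ (J : Vec A k) {φ} → (∀ s → φ (φ s) ≡ s) → J ⟪ φ ⟫ ⟪ φ ⟫ ≡ J
  ⟪⟫-involutive J {φ} inv =
    ≡.trans (⟪⟫-∘ J φ φ) (≡.trans (⟪⟫-cong J inv) (Vec.tabulate∘lookup J))

  ⟪⟫-[]≔ : ∀ (J : Vec A k) {φ} → (∀ {s t} → φ s ≡ φ t → s ≡ t) → ∀ {s} → φ s ≡ s →
           ∀ x → (J [ s ]≔ x) ⟪ φ ⟫ ≡ J ⟪ φ ⟫ [ s ]≔ x
  ⟪⟫-[]≔ J {φ} φ-inj {s} φs≡s x = lookup-extensional pointwise
    where
    pointwise : lookup ((J [ s ]≔ x) ⟪ φ ⟫) ≗ lookup (J ⟪ φ ⟫ [ s ]≔ x)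
    pointwise t with t Fin.≟ s
    ... | yes ≡.refl = ≡.trans (lookup-⟪⟫ (J [ s ]≔ x) φ s)
      (≡.trans (≡.cong (lookup (J [ s ]≔ x)) φs≡s)
      (≡.trans (Vec.lookup∘update s J x) (≡.sym (Vec.lookup∘update s (J ⟪ φ ⟫) x))))
    ... | no t≢s = ≡.trans (lookup-⟪⟫ (J [ s ]≔ x) φ t)
      (≡.trans (Vec.lookup∘update′ (λ φt≡s → t≢s (φ-inj (≡.trans φt≡s (≡.sym φs≡s)))) J x)
      (≡.trans (≡.sym (lookup-⟪⟫ J φ t)) (≡.sym (Vec.lookup∘update′ t≢s (J ⟪ φ ⟫) x))))

-- Relations between permutation operators and one-factor matrices

endTensorRing : (n k : ℕ) → Ring c ℓ → Ring c ℓ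
endTensorRing n k = MatrixRing.matrixRing _≟ᵛ_ (allVectors-unique n k) allVectors-complete

module TensorProperties (n k : ℕ) (R : Ring c ℓ) where
  open Ring R
  open ListFolds rawRing
  open FoldProperties R
  open TensorOps n k rawRing
  private
    module End = Ring (endTensorRing n k R)
    𝟙 : Bool → Carrier
    𝟙 b = if b then 1# else 0#

  *-P : ∀ (X : Tensor) i j I J → (X End.* P i j) I J ≈ X I (J ⟪ transpose i j ⟫)
  *-P X i j I J = ∑-δʳ (λ K → X I K) (allVectors-unique n k) (allVectors-complete _)
    (dec-true (K₀ ≟ᵛ K₀) ≡.refl) (λ K → dec-false (K ≟ᵛ K₀))
    where K₀ = J ⟪ transpose i j ⟫

  -- A transposition is its own inverse, so the only 1 in row `I` of `P i j` sits in column
  -- `I ⟪ transpose i j ⟫`.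
  P-* : ∀ (X : Tensor) i j I J → (P i j End.* X) I J ≈ X (I ⟪ transpose i j ⟫) J
  P-* X i j I J = ∑-δˡ (λ K → X K J) (allVectors-unique n k) (allVectors-complete _)
    (dec-true (I ≟ᵛ _) (≡.sym (⟪⟫-involutive I (transpose-involutive i j))))
    (λ K K≢ → dec-false (I ≟ᵛ _) (λ { ≡.refl → K≢ (≡.sym (⟪⟫-involutive K (transpose-involutive i j))) }))

  P-sym : ∀ i j → P i j End.≈ P j i
  P-sym i j I J = reflexive (≡.cong (λ K → 𝟙 (does (I ≟ᵛ K))) (⟪⟫-cong J (transpose-comm i j)))

  -- Both products are permutation matrices, with entry 1 where I ∘ τ = J ∘ (τi τj) and where I = J
  -- ∘ τ ∘ (i j) respectively. As τ is an involution, `transpose-conjugate` identifies the two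
  -- conditions.
  P-conjugate : ∀ i j s t → (P s t End.* P (transpose s t i) (transpose s t j)) End.≈ (P i j End.* P s t)
  P-conjugate i j s t I J = trans (P-* (P (τ i) (τ j)) s t I J)
    (trans (reflexive (≡.cong 𝟙 (does-⇔ (mk⇔ to from) (_ ≟ᵛ _) (_ ≟ᵛ _)))) (sym (*-P (P i j) s t I J)))
    where
    τ = transpose s t
    conj : J ⟪ transpose (τ i) (τ j) ⟫ ⟪ τ ⟫ ≡ J ⟪ τ ⟫ ⟪ transpose i j ⟫
    conj = ≡.trans (⟪⟫-∘ J _ _) (≡.trans
      (⟪⟫-cong J (λ u → ≡.sym (transpose-conjugate τ (transpose-injective s t) i j u)))
      (≡.sym (⟪⟫-∘ J _ _)))
    to : I ⟪ τ ⟫ ≡ J ⟪ transpose (τ i) (τ j) ⟫ → I ≡ J ⟪ τ ⟫ ⟪ transpose i j ⟫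
    to eq = ≡.trans (≡.sym (⟪⟫-involutive I (transpose-involutive s t)))
      (≡.trans (≡.cong (_⟪ τ ⟫) eq) conj)
    from : I ≡ J ⟪ τ ⟫ ⟪ transpose i j ⟫ → I ⟪ τ ⟫ ≡ J ⟪ transpose (τ i) (τ j) ⟫
    from eq = ≡.trans (≡.cong (_⟪ τ ⟫) (≡.trans eq (≡.sym conj)))
      (⟪⟫-involutive _ (transpose-involutive s t))

  -- The transposition fixes position `s`, so it preserves both the index read by `X` and the
  -- condition that all other positions agree.
  at-P-comm : ∀ {s i j} (X : Fin n → Fin n → Carrier) → s ≢ i → s ≢ j →
              (at s X End.* P i j) End.≈ (P i j End.* at s X)
  at-P-comm {s} {i} {j} X s≢i s≢j I J =
    trans (*-P (at s X) i j I J) (trans (reflexive eq) (sym (P-* (at s X) i j I J)))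
    where
    τ = transpose i j
    τs≡s : τ s ≡ s
    τs≡s = transpose-mismatch s≢i s≢j
    fixed : ∀ (K : Vec (Fin n) k) → lookup (K ⟪ τ ⟫) s ≡ lookup K s
    fixed K = ≡.trans (lookup-⟪⟫ K τ s) (≡.cong (lookup K) τs≡s)
    to : I ≡ J ⟪ τ ⟫ [ s ]≔ lookup I s → I ⟪ τ ⟫ ≡ J [ s ]≔ lookup I s
    to p = ≡.trans (≡.cong (_⟪ τ ⟫) (≡.trans p (≡.sym (⟪⟫-[]≔ J (transpose-injective i j) τs≡s _))))
      (⟪⟫-involutive _ (transpose-involutive i j))
    from : I ⟪ τ ⟫ ≡ J [ s ]≔ lookup I s → I ≡ J ⟪ τ ⟫ [ s ]≔ lookup I s
    from p = ≡.trans (≡.sym (⟪⟫-involutive I (transpose-involutive i j)))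
      (≡.trans (≡.cong (_⟪ τ ⟫) p) (⟪⟫-[]≔ J (transpose-injective i j) τs≡s _))
    eq : at s X I (J ⟪ τ ⟫) ≡ at s X (I ⟪ τ ⟫) J
    eq rewrite fixed J | fixed I = ≡.cong (if_then X (lookup I s) (lookup J s) else 0#)
      (does-⇔ (mk⇔ to from) (_ ≟ᵛ _) (_ ≟ᵛ _))

-- Signs of permutations

private
  [_<?_] [_≟?_] : ∀ {n} → Fin n → Fin n → ℕ
  [ y <? x ] = if does (y Fin.<? x) then 1 else 0
  [ y ≟? x ] = if does (y Fin.≟ x) then 1 else 0

count-∷ : ∀ {A : Set a} {p} {P : A → Set p} (P? : ∀ x → Dec (P x)) {k} y (ys : Vec A k) →
          count P? (y ∷ ys) ≡ (if does (P? y) then 1 else 0) +ℕ count P? ys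
count-∷ P? y ys with does (P? y)
... | true  = ≡.refl
... | false = ≡.refl

-- When the adjacent values i and j = i + 1 are exchanged, the pairs counted by
-- pairs i j become inversions and those counted by pairs j i cease to be so.
pairs : ∀ {n k} → Fin n → Fin n → Vec (Fin n) k → ℕ
pairs i j []       = 0
pairs i j (x ∷ xs) = (if does (x Fin.≟ i) then count (Fin._≟ j) xs else 0) +ℕ pairs i j xs

module _ {n} {i j : Fin n} (j≡1+i : toℕ j ≡ suc (toℕ i)) where
  private
    τ = transpose i j

    i≢j : i ≢ j
    i≢j ≡.refl = ℕ.1+n≢n (≡.sym j≡1+i)

    i<j : i Fin.< j
    i<j = ℕ.≤-reflexive (≡.sym j≡1+i)

    j≮i : ¬ j Fin.< i
    j≮i = ℕ.<-asym i<j

    <j⇒<i : ∀ {x} → x ≢ i → x Fin.< j → x Fin.< i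
    <j⇒<i x≢i x<j = ℕ.≤∧≢⇒< (ℕ.≤-pred (≡.subst (_ ℕ.<_) j≡1+i x<j)) (x≢i ∘ Fin.toℕ-injective)

    i<⇒j< : ∀ {x} → x ≢ j → i Fin.< x → j Fin.< x
    i<⇒j< x≢j i<x = ℕ.≤∧≢⇒< (≡.subst (ℕ._≤ _) (≡.sym j≡1+i) i<x) (≢-sym x≢j ∘ Fin.toℕ-injective)

    <?-cong : ∀ {x y x′ y′ : Fin n} → (x Fin.< y → x′ Fin.< y′) → (x′ Fin.< y′ → x Fin.< y) →
              [ x <? y ] ≡ [ x′ <? y′ ]
    <?-cong f g = ≡.cong (if_then 1 else 0) (does-⇔ (mk⇔ f g) (_ Fin.<? _) (_ Fin.<? _))

    <?-yes : ∀ {x y : Fin n} → x Fin.< y → [ x <? y ] ≡ 1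
    <?-yes p = ≡.cong (if_then 1 else 0) (dec-true (_ Fin.<? _) p)

    <?-no : ∀ {x y : Fin n} → ¬ x Fin.< y → [ x <? y ] ≡ 0
    <?-no p = ≡.cong (if_then 1 else 0) (dec-false (_ Fin.<? _) p)

    <?-irrefl : ∀ (x : Fin n) → [ x <? x ] ≡ 0
    <?-irrefl x = <?-no {x} {x} (ℕ.<-irrefl ≡.refl)

    ≟?-no : ∀ {x y : Fin n} → x ≢ y → [ x ≟? y ] ≡ 0
    ≟?-no p = ≡.cong (if_then 1 else 0) (dec-false (_ Fin.≟ _) p)

    -- No value lies strictly between `i` and `j`, so both compare alike with any third value.
    below-other : ∀ {x} y → x ≢ i → x ≢ j → [ τ y <? x ] ≡ [ y <? x ]
    below-other {x} y x≢i x≢j with y Fin.≟ i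
    ... | yes ≡.refl = <?-cong (ℕ.<-trans i<j) (i<⇒j< x≢j)
    ... | no  _ with y Fin.≟ j
    ...   | yes ≡.refl = <?-cong (i<⇒j< x≢j) (ℕ.<-trans i<j)
    ...   | no  _      = ≡.refl

    -- The values that `τ` carries below `j` are `j` itself, which goes to `i`, and those already
    -- below `i`, which are fixed.
    below-j : ∀ y → [ τ y <? j ] ≡ [ y ≟? j ] +ℕ [ y <? i ]
    below-j y with y Fin.≟ i
    ... | yes ≡.refl = ≡.trans (<?-irrefl j)
                       (≡.sym (≡.cong₂ _+ℕ_ (≟?-no i≢j) (<?-irrefl i)))
    ... | no  y≢i with y Fin.≟ j
    ...   | yes ≡.refl = ≡.trans (<?-yes i<j) (≡.cong suc (≡.sym (<?-no j≮i)))
    ...   | no  _      = <?-cong (<j⇒<i y≢i) (λ y<i → ℕ.<-trans y<i i<j)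

    below-i : ∀ y → [ y <? j ] ≡ [ y ≟? i ] +ℕ [ τ y <? i ]
    below-i y with y Fin.≟ i
    ... | yes ≡.refl = ≡.trans (<?-yes i<j) (≡.cong suc (≡.sym (<?-no j≮i)))
    ... | no  y≢i with y Fin.≟ j
    ...   | yes ≡.refl = ≡.trans (<?-irrefl j) (≡.sym (<?-irrefl i))
    ...   | no  _      = <?-cong (<j⇒<i y≢i) (λ y<i → ℕ.<-trans y<i i<j)

    interchangeℕ = CommutativeSemigroupProperties.interchange ℕ.+-commutativeSemigroup

    count-other : ∀ {x k} (ys : Vec (Fin n) k) → x ≢ i → x ≢ j →
                  count (Fin._<? x) (Vec.map τ ys) ≡ count (Fin._<? x) ys
    count-other []       _   _   = ≡.refl
    count-other {x} (y ∷ ys) x≢i x≢j = ≡.trans (count-∷ (Fin._<? x) (τ y) (Vec.map τ ys)) (≡.trans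
      (≡.cong₂ _+ℕ_ (below-other y x≢i x≢j) (count-other ys x≢i x≢j))
      (≡.sym (count-∷ (Fin._<? x) y ys)))

    count-j : ∀ {k} (ys : Vec (Fin n) k) →
              count (Fin._<? j) (Vec.map τ ys) ≡ count (Fin._≟ j) ys +ℕ count (Fin._<? i) ys
    count-j []       = ≡.refl
    count-j (y ∷ ys) = ≡.trans (count-∷ (Fin._<? j) (τ y) (Vec.map τ ys)) (≡.trans
      (≡.cong₂ _+ℕ_ (below-j y) (count-j ys)) (≡.trans
      (interchangeℕ [ y ≟? j ] [ y <? i ] _ _)
      (≡.sym (≡.cong₂ _+ℕ_ (count-∷ (Fin._≟ j) y ys) (count-∷ (Fin._<? i) y ys)))))

    count-i : ∀ {k} (ys : Vec (Fin n) k) →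
              count (Fin._<? j) ys ≡ count (Fin._≟ i) ys +ℕ count (Fin._<? i) (Vec.map τ ys)
    count-i []       = ≡.refl
    count-i (y ∷ ys) = ≡.trans (count-∷ (Fin._<? j) y ys) (≡.trans
      (≡.cong₂ _+ℕ_ (below-i y) (count-i ys)) (≡.trans
      (interchangeℕ [ y ≟? i ] [ τ y <? i ] _ _)
      (≡.sym (≡.cong₂ _+ℕ_ (count-∷ (Fin._≟ i) y ys) (count-∷ (Fin._<? i) (τ y) (Vec.map τ ys))))))

  -- Only pairs made of an `i` and a `j` change their order. The additive form avoids subtraction,
  -- and admitting repeated entries lets the induction run over arbitrary vectors.
  inversions-transpose : ∀ {k} (xs : Vec (Fin n) k) →
    inversions (Vec.map τ xs) +ℕ pairs j i xs ≡ inversions xs +ℕ pairs i j xs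
  inversions-transpose []       = ≡.refl
  inversions-transpose (x ∷ xs) = ≡.trans (interchangeℕ (count (Fin._<? τ x) (Vec.map τ xs)) _ _ _)
    (≡.trans (≡.cong₂ _+ℕ_ (head x) (inversions-transpose xs))
    (≡.sym (interchangeℕ (count (Fin._<? x) xs) _ _ _)))
    where
    head : ∀ x → count (Fin._<? τ x) (Vec.map τ xs) +ℕ (if does (x Fin.≟ j) then count (Fin._≟ i) xs else 0)
                 ≡ count (Fin._<? x) xs +ℕ (if does (x Fin.≟ i) then count (Fin._≟ j) xs else 0)
    head x with x Fin.≟ i
    ... | yes ≡.refl rewrite dec-false (x Fin.≟ j) i≢j =
      ≡.trans (ℕ.+-identityʳ _) (≡.trans (count-j xs) (ℕ.+-comm (count (Fin._≟ j) xs) _))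
    ... | no x≢i with x Fin.≟ j
    ...   | yes ≡.refl = ≡.trans (ℕ.+-comm (count (Fin._<? i) (Vec.map τ xs)) _)
                         (≡.trans (≡.sym (count-i xs)) (≡.sym (ℕ.+-identityʳ _)))
    ...   | no  x≢j    = ≡.cong (_+ℕ 0) (count-other xs x≢i x≢j)

module _ {n} {i j : Fin n} (i≢j : i ≢ j) where

  -- An occurrence of `i` and an occurrence of `j` stand in exactly one of the two orders.
  pairs-+ : ∀ {k} (xs : Vec (Fin n) k) → pairs i j xs +ℕ pairs j i xs ≡ count (Fin._≟ i) xs *ℕ count (Fin._≟ j) xs
  pairs-+ []       = ≡.refl
  pairs-+ (x ∷ xs) with x Fin.≟ i
  ... | yes ≡.refl rewrite dec-false (x Fin.≟ j) i≢j =
    ≡.trans (ℕ.+-assoc (count (Fin._≟ j) xs) _ _) (≡.cong (count (Fin._≟ j) xs +ℕ_) (pairs-+ xs))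
  ... | no x≢i with x Fin.≟ j
  ...   | no  _      = pairs-+ xs
  ...   | yes ≡.refl = begin
    pairs i j xs +ℕ (ci +ℕ pairs j i xs)  ≡⟨ ℕ.+-assoc (pairs i j xs) ci _ ⟨
    pairs i j xs +ℕ ci +ℕ pairs j i xs    ≡⟨ ≡.cong (_+ℕ pairs j i xs) (ℕ.+-comm (pairs i j xs) ci) ⟩
    ci +ℕ pairs i j xs +ℕ pairs j i xs    ≡⟨ ℕ.+-assoc ci _ _ ⟩
    ci +ℕ (pairs i j xs +ℕ pairs j i xs)  ≡⟨ ≡.cong (ci +ℕ_) (pairs-+ xs) ⟩
    ci +ℕ ci *ℕ cj                        ≡⟨ ℕ.*-suc ci cj ⟨
    ci *ℕ suc cj                          ∎
    where
    open ≡.≡-Reasoning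
    ci = count (Fin._≟ i) xs
    cj = count (Fin._≟ j) xs

count-absent : ∀ {n k} {i : Fin n} {xs : Vec (Fin n) k} → VecAll.All (i ≢_) xs → count (Fin._≟ i) xs ≡ 0
count-absent []                            = ≡.refl
count-absent {i = i} {x ∷ xs} (i≢x ∷ i∉xs) = ≡.trans (count-∷ (Fin._≟ i) x xs)
  (≡.cong₂ _+ℕ_ (≡.cong (if_then 1 else 0) (dec-false (x Fin.≟ i) (≢-sym i≢x))) (count-absent i∉xs))

count-present : ∀ {n k} {xs : Vec (Fin n) k} → Vec.Unique xs → ∀ s → count (Fin._≟ lookup xs s) xs ≡ 1
count-present {xs = x ∷ xs} (x∉ ∷ u) zero    = ≡.trans (count-∷ (Fin._≟ x) x xs)
  (≡.cong₂ _+ℕ_ (≡.cong (if_then 1 else 0) (dec-true (x Fin.≟ x) ≡.refl)) (count-absent x∉))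
count-present {xs = x ∷ xs} (x∉ ∷ u) (suc s) = ≡.trans (count-∷ (Fin._≟ lookup xs s) x xs)
  (≡.cong₂ _+ℕ_ (≡.cong (if_then 1 else 0) (dec-false (x Fin.≟ lookup xs s) (VecAll.lookup⁺ x∉ s)))
    (count-present u s))

-- A missed value could be punched out of the codomain, leaving an injection of `Fin (suc n)` into
-- `Fin n`.
injective⇒surjective : ∀ {n} {f : Fin n → Fin n} → (∀ {s t} → f s ≡ f t → s ≡ t) → ∀ i → ∃ λ s → f s ≡ i
injective⇒surjective {suc n} {f} f-inj i with Fin.any? (λ s → f s Fin.≟ i)
... | yes s∈ = s∈
... | no  i∉ = contradiction
  (λ {s} {t} eq → f-inj (Fin.punchOut-injective (missed s) (missed t) eq)) (Fin.<⇒notInjective (ℕ.n<1+n n))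
  where
  missed : ∀ s → i ≢ f s
  missed s i≡fs = i∉ (s , ≡.sym i≡fs)

permutation-count : ∀ {n} {σ : Vec (Fin n) n} → Vec.Unique σ → ∀ i → count (Fin._≟ i) σ ≡ 1
permutation-count {σ = σ} u i
  with s , ≡.refl ← injective⇒surjective {f = lookup σ} (λ {s} {t} → VecUnique.lookup-injective u s t) i = count-present u s

-- Both values occur once, so one of `pairs i j σ` and `pairs j i σ` is 1 and the other 0; which one
-- it is decides whether an inversion is gained or lost.
inversions-parity : ∀ {n} {i j : Fin n} → toℕ j ≡ suc (toℕ i) → {σ : Vec (Fin n) n} → Vec.Unique σ →
  let σ′ = Vec.map (transpose i j) σ in
  inversions σ′ ≡ suc (inversions σ) ⊎ inversions σ ≡ suc (inversions σ′)
inversions-parity {i = i} {j} j≡1+i {σ} u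
  with pairs i j σ | pairs j i σ | inversions-transpose j≡1+i σ
     | ≡.trans (pairs-+ (λ { ≡.refl → ℕ.1+n≢n (≡.sym j≡1+i) }) σ)
               (≡.cong₂ _*ℕ_ (permutation-count u i) (permutation-count u j))
... | 0 | 1 | eq | _ = inj₂ (≡.trans (≡.sym (ℕ.+-identityʳ _)) (≡.trans (≡.sym eq) (ℕ.+-comm _ 1)))
... | 1 | 0 | eq | _ = inj₁ (≡.trans (≡.sym (ℕ.+-identityʳ _)) (≡.trans eq (ℕ.+-comm _ 1)))
... | 0 | 0 | _  | ()
... | 0 | suc (suc _) | _ | ()
... | 1 | suc _ | _ | ()
... | suc (suc _) | _ | _ | ()

∈-permutations⁺ : ∀ {n} {σ : Vec (Fin n) n} → Vec.Unique σ → σ ∈ permutations n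
∈-permutations⁺ {σ = σ} u = ∈-filter⁺ unique? (allVectors-complete σ) u

∈-permutations⁻ : ∀ {n} {σ : Vec (Fin n) n} → σ ∈ permutations n → Vec.Unique σ
∈-permutations⁻ {n} σ∈ = proj₂ (∈-filter⁻ unique? {xs = allVectors n n} σ∈)

-- Antisymmetry of Aₙ under adjacent transpositions

module AntisymmetrizerProperties (n : ℕ) (R : Ring c ℓ) where
  open Ring R
  open ListFolds rawRing
  open FoldProperties R
  open TensorOps n n rawRing
  open TensorProperties n n R
  open RingProperties R using (-1*x≈-x; -‿involutive)
  open RawSemiringDefinitions (RawRing.rawSemiring rawRing) using (_^_)
  open import Relation.Binary.Reasoning.Setoid setoid
  private
    module End = Ring (endTensorRing n n R)
    A : Tensor
    A = antisymmetrizer n rawRing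

    sgn : ∀ {k} → Vec (Fin n) k → Carrier
    sgn σ = (- 1#) ^ inversions σ

  sgn-transpose : ∀ {i j : Fin n} → toℕ j ≡ suc (toℕ i) → {σ : Vec (Fin n) n} → Vec.Unique σ →
                  sgn σ ≈ - sgn (Vec.map (transpose i j) σ)
  sgn-transpose {i} {j} j≡1+i {σ} u with inversions-parity j≡1+i u
  ... | inj₁ eq = begin
    sgn σ                    ≈⟨ -‿involutive _ ⟨
    - - sgn σ                ≈⟨ -‿cong (-1*x≈-x _) ⟨
    - (- 1# * sgn σ)         ≡⟨ ≡.cong (λ k → - ((- 1#) ^ k)) eq ⟨
    - sgn (Vec.map (transpose i j) σ) ∎
  ... | inj₂ eq = trans (reflexive (≡.cong ((- 1#) ^_) eq)) (-1*x≈-x _)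

  -- Multiplication by `P i j` replaces J by J ∘ τ, so the term of σ becomes, up to sign, the term
  -- of τσ in `A`. Passing from σ to τσ exchanges the values `i` and `j` of σ, not its positions,
  -- and it permutes Sₙ.
  A-adjacent : ∀ {i j : Fin n} → toℕ j ≡ suc (toℕ i) → (A End.* P i j) End.≈ (End.- A)
  A-adjacent {i} {j} j≡1+i I J = begin
    (A End.* P i j) I J
      ≈⟨ *-P A i j I J ⟩
    ∑ (permutations n) (λ σ → if does (I ≟ᵛ Vec.map (lookup (J ⟪ τ ⟫)) σ) then sgn σ else 0#)
      ≈⟨ ∑-cong-All (All.tabulate (λ σ∈ → termwise _ (∈-permutations⁻ σ∈))) ⟩
    ∑ (permutations n) (λ σ → - 1# * term (Vec.map τ σ))
      ≈⟨ ∑-distribˡ (permutations n) (- 1#) (term ∘ Vec.map τ) ⟨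
    - 1# * ∑ (permutations n) (term ∘ Vec.map τ)
      ≈⟨ *-congˡ (∑-involution term (Unique.filter⁺ unique? (allVectors-unique n n)) map-involutive
           (∈-permutations⁺ ∘ VecUnique.map⁺ (transpose-injective i j) ∘ ∈-permutations⁻)) ⟩
    - 1# * A I J
      ≈⟨ -1*x≈-x _ ⟩
    - A I J ∎
    where
    τ = transpose i j
    term : Vec (Fin n) n → Carrier
    term σ = if does (I ≟ᵛ Vec.map (lookup J) σ) then sgn σ else 0#

    map-involutive : ∀ (σ : Vec (Fin n) n) → Vec.map τ (Vec.map τ σ) ≡ σ
    map-involutive σ = ≡.trans (≡.sym (Vec.map-∘ τ τ σ))
      (≡.trans (Vec.map-cong (transpose-involutive i j) σ) (Vec.map-id σ))

    termwise : ∀ (σ : Vec (Fin n) n) → Vec.Unique σ →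
      (if does (I ≟ᵛ Vec.map (lookup (J ⟪ τ ⟫)) σ) then sgn σ else 0#) ≈ - 1# * term (Vec.map τ σ)
    termwise σ u rewrite ≡.trans (Vec.map-cong (lookup-⟪⟫ J τ) σ) (Vec.map-∘ (lookup J) τ σ)
      with does (I ≟ᵛ Vec.map (lookup J) (Vec.map τ σ))
    ... | true  = trans (sgn-transpose j≡1+i u) (sym (-1*x≈-x _))
    ... | false = sym (zeroʳ _)

-- The labels beyond k as lists

-- Restated without the field and the other parameters of `SklyaninDeterminant`; it agrees
-- definitionally with the list used there.
above : ∀ {n} → Fin n → List (Fin n)
above {n} i = filter (i Fin.<?_) (allFin n)

-- The lists k, k + 1, …, n - 1 (counting from 0).
data Run {n : ℕ} : List (Fin n) → Set where
  []  : Run []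
  run : ∀ {k ks} → above k ≡ ks → suc (toℕ k) +ℕ length ks ≡ n → Run ks → Run (k ∷ ks)

above-suc : ∀ {n} (i : Fin n) → above (suc i) ≡ map suc (above i)
above-suc {n} i = ≡.trans
  (≡.cong (filter (suc i Fin.<?_)) (≡.sym (List.map-tabulate {n = n} id suc)))
  (filter-map-suc (allFin n))
  where
  filter-map-suc : ∀ xs → filter (suc i Fin.<?_) (map suc xs) ≡ map suc (filter (i Fin.<?_) xs)
  filter-map-suc []       = ≡.refl
  filter-map-suc (x ∷ xs) with does (i Fin.<? x)
  ... | true  = ≡.cong (suc x ∷_) (filter-map-suc xs)
  ... | false = filter-map-suc xs

-- Prepares the induction on n: after `zero`, the list `allFin (suc n)` is the image of `allFin n`
-- under `suc`.
run-map-suc : ∀ {n} {ks : List (Fin n)} → Run ks → Run (map suc ks)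
run-map-suc []                        = []
run-map-suc (run {k} {ks} eq len r) = run
  (≡.trans (above-suc k) (≡.cong (map suc) eq))
  (≡.cong suc (≡.trans (≡.cong (λ e → suc (toℕ k) +ℕ e) (List.length-map suc ks)) len))
  (run-map-suc r)

run-allFin : ∀ n → Run (allFin n)
run-allFin zero    = []
run-allFin (suc n) = run
  (List.filter-all (zero {n} Fin.<?_) (All.tabulate⁺ {f = suc} (λ _ → s≤s z≤n)))
  (≡.cong suc (List.length-tabulate {n = n} suc))
  (≡.subst Run (List.map-tabulate {n = n} id suc) (run-map-suc (run-allFin n)))

above-unique : ∀ {n} (i : Fin n) → Unique (above i)
above-unique {n} i = Unique.filter⁺ (i Fin.<?_) (Unique.allFin⁺ n)

∉-above : ∀ {n} (i : Fin n) → i ∉ above i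
∉-above {n} i i∈ = ℕ.<-irrefl ≡.refl (proj₂ (∈-filter⁻ (i Fin.<?_) {xs = allFin n} i∈))

-- The truncated subtractions in the labels of R and Π are exact.
index-+ : ∀ k {j m n} → suc j +ℕ m ≡ n → suc k +ℕ n ∸ 2 ≡ (suc k +ℕ suc j ∸ 2) +ℕ m
index-+ k {j} {m} ≡.refl = begin
  k +ℕ suc (j +ℕ m) ∸ 1   ≡⟨ ≡.cong (_∸ 1) (ℕ.+-suc k _) ⟩
  k +ℕ (j +ℕ m)           ≡⟨ ℕ.+-assoc k _ _ ⟨
  k +ℕ j +ℕ m             ≡⟨ ≡.cong (λ e → e ∸ 1 +ℕ m) (ℕ.+-suc k j) ⟨
  (k +ℕ suc j ∸ 1) +ℕ m   ∎
  where open ≡.≡-Reasoning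

-- Straightening products of transpositions under an antisymmetric factor

-- Suitable choices of the four labels give the commutation of disjoint transpositions, the relation
-- `P-star`, and the passage from adjacent transpositions to all of them.
Conjugation : (M : Ring c ℓ) {n : ℕ} → (Fin n → Fin n → Ring.Carrier M) → Set ℓ
Conjugation M P = ∀ i j s t → let open Ring M; τ = transpose s t in
  P s t * P (τ i) (τ j) ≈ P i j * P s t

module Straightening (M : Ring c ℓ) {n : ℕ} (P : Fin n → Fin n → Ring.Carrier M)
  (P-conjugate : Conjugation M P) where
  open Ring M
  open ListFolds rawRing
  open FoldProperties M
  open RingProperties M using (-‿distribˡ-*; -‿distribʳ-*; -‿involutive; -‿+-comm; -0#≈0#; -1*x≈-x)
  open SemiringMult semiring using (×-congʳ; ×-comm-*; ×-assoc-*) renaming (_×_ to _×′_)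
  open import Relation.Binary.Reasoning.Setoid setoid

  Antisymmetric : List (Fin n) → Carrier → Set _
  Antisymmetric L Z = ∀ {i j} → i ∈ L → j ∈ L → i ≢ j → Z * P i j ≈ - Z

  Central : Carrier → Set _
  Central x = ∀ y → x * y ≈ y * x

  CommutesWithP : List (Fin n) → Carrier → Set _
  CommutesWithP L X = ∀ {i j} → i ∈ L → j ∈ L → i ≢ j → X * P i j ≈ P i j * X

  antisymmetric-* : ∀ {L Z X} → Antisymmetric L Z → CommutesWithP L X → Antisymmetric L (Z * X)
  antisymmetric-* {Z = Z} {X} anti comm {i} {j} i∈ j∈ i≢j = begin
    Z * X * P i j     ≈⟨ *-assoc _ _ _ ⟩
    Z * (X * P i j)   ≈⟨ *-congˡ (comm i∈ j∈ i≢j) ⟩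
    Z * (P i j * X)   ≈⟨ *-assoc _ _ _ ⟨
    Z * P i j * X     ≈⟨ *-congʳ (anti i∈ j∈ i≢j) ⟩
    - Z * X           ≈⟨ -‿distribˡ-* _ _ ⟨
    - (Z * X)         ∎

  antisymmetric-tail : ∀ {k L Z} → Antisymmetric (k ∷ L) Z → Antisymmetric L Z
  antisymmetric-tail anti i∈ j∈ = anti (there i∈) (there j∈)

  P-comm : ∀ {k l i j} → k ≢ i → k ≢ j → l ≢ i → l ≢ j → P k l * P i j ≈ P i j * P k l
  P-comm {k} {l} {i} {j} k≢i k≢j l≢i l≢j = sym (trans
    (*-congˡ (reflexive (≡.sym (≡.cong₂ P (transpose-mismatch k≢i k≢j) (transpose-mismatch l≢i l≢j)))))
    (P-conjugate k l i j))

  -- Conjugation by (k j), which carries j to k and fixes i.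
  P-star : ∀ {k i j} → k ≢ i → j ≢ i → P k j * P k i ≈ P j i * P k j
  P-star {k} {i} {j} k≢i j≢i = trans
    (*-congˡ (reflexive (≡.sym (≡.cong₂ P (transpose-matchʳ k j) (transpose-mismatch (≢-sym k≢i) (≢-sym j≢i))))))
    (P-conjugate j i k j)

  commute-1-xX : ∀ {x X Y} → Central x → X * Y ≈ Y * X → (1# + - (x * X)) * Y ≈ Y * (1# + - (x * X))
  commute-1-xX {x} {X} {Y} central comm = begin
    (1# + - (x * X)) * Y        ≈⟨ distribʳ _ _ _ ⟩
    1# * Y + - (x * X) * Y      ≈⟨ +-cong (trans (*-identityˡ _) (sym (*-identityʳ _))) (sym (-‿distribˡ-* _ _)) ⟩
    Y * 1# + - (x * X * Y)      ≈⟨ +-congˡ (-‿cong (begin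
      x * X * Y                   ≈⟨ *-assoc _ _ _ ⟩
      x * (X * Y)                 ≈⟨ *-congˡ comm ⟩
      x * (Y * X)                 ≈⟨ *-assoc _ _ _ ⟨
      x * Y * X                   ≈⟨ *-congʳ (central Y) ⟩
      Y * x * X                   ≈⟨ *-assoc _ _ _ ⟩
      Y * (x * X)                 ∎)) ⟩
    Y * 1# + - (Y * (x * X))    ≈⟨ +-congˡ (-‿distribʳ-* _ _) ⟩
    Y * 1# + Y * - (x * X)      ≈⟨ distribˡ _ _ _ ⟨
    Y * (1# + - (x * X))        ∎

  *-1-xX : ∀ {x} Z X → Central x → Z * (1# + - (x * X)) ≈ Z + - (x * (Z * X))
  *-1-xX {x} Z X central = begin
    Z * (1# + - (x * X))        ≈⟨ distribˡ _ _ _ ⟩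
    Z * 1# + Z * - (x * X)      ≈⟨ +-cong (*-identityʳ Z) (sym (-‿distribʳ-* _ _)) ⟩
    Z + - (Z * (x * X))         ≈⟨ +-congˡ (-‿cong (*-assoc _ _ _)) ⟨
    Z + - (Z * x * X)           ≈⟨ +-congˡ (-‿cong (*-congʳ (central Z))) ⟨
    Z + - (x * Z * X)           ≈⟨ +-congˡ (-‿cong (*-assoc _ _ _)) ⟩
    Z + - (x * (Z * X))         ∎

  -- Conjugation by (i j) fixes `k` and permutes `L`, hence only permutes the summands.
  ∑P-commutes : ∀ {k L} → Unique L → k ∉ L → CommutesWithP L (∑ L (P k))
  ∑P-commutes {k} {L} u k∉ {i} {j} i∈ j∈ _ = begin
    ∑ L (P k) * P i j                ≈⟨ ∑-distribʳ L _ _ ⟩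
    ∑ L (λ s → P k s * P i j)        ≈⟨ ∑-cong L (λ s → sym (trans
                                          (*-congˡ (reflexive (≡.cong (λ t → P t (τ s)) (≡.sym τk≡k))))
                                          (P-conjugate k s i j))) ⟩
    ∑ L (λ s → P i j * P k (τ s))    ≈⟨ ∑-distribˡ L _ _ ⟨
    P i j * ∑ L (P k ∘ τ)            ≈⟨ *-congˡ (∑-involution (P k) u (transpose-involutive i j) (transpose-∈ i∈ j∈)) ⟩
    P i j * ∑ L (P k)                ∎
    where
    τ = transpose i j
    τk≡k : τ k ≡ k
    τk≡k = transpose-mismatch (λ { ≡.refl → k∉ i∈ }) (λ { ≡.refl → k∉ j∈ })

  -- Induction on the number d of labels strictly between i and j. With k = j - 1, conjugation gives
  -- P_{kj} P_{ij} = P_{ik} P_{kj}, and i, k are closer. Inserting P_{kj} after Z, absorbing P_{ik}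
  -- and absorbing P_{kj} each cost one sign.
  adjacent⇒antisymmetric : ∀ {Z} → (∀ i j → P i j ≈ P j i) →
    (∀ {i j} → toℕ j ≡ suc (toℕ i) → Z * P i j ≈ - Z) → ∀ {L} → Antisymmetric L Z
  adjacent⇒antisymmetric {Z} P-sym adjacent {i = i} {j} _ _ i≢j = go (ℕ.<-cmp (toℕ i) (toℕ j))
    where
    distance : ∀ d {i j} → toℕ j ≡ suc (d +ℕ toℕ i) → Z * P i j ≈ - Z
    distance zero            eq = adjacent eq
    distance (suc d) {i} {j} eq = begin
      Z * P i j                  ≈⟨ *-congʳ (-‿involutive Z) ⟨
      - - Z * P i j              ≈⟨ *-congʳ (-‿cong (adjacent j≡1+k)) ⟨
      - (Z * P k j) * P i j      ≈⟨ -‿distribˡ-* _ _ ⟨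
      - (Z * P k j * P i j)      ≈⟨ -‿cong (*-assoc _ _ _) ⟩
      - (Z * (P k j * P i j))    ≈⟨ -‿cong (*-congˡ (*-congˡ (reflexive (≡.cong₂ P
                                      (≡.sym (transpose-mismatch (i≢ k (ℕ.m≤n+m _ d) k≡) (i≢ j (ℕ.m≤n+m _ (suc d)) eq)))
                                      (≡.sym (transpose-matchˡ k j)))))) ⟩
      - (Z * (P k j * P (transpose k j i) (transpose k j k)))
                                 ≈⟨ -‿cong (*-congˡ (P-conjugate i k k j)) ⟩
      - (Z * (P i k * P k j))    ≈⟨ -‿cong (*-assoc _ _ _) ⟨
      - (Z * P i k * P k j)      ≈⟨ -‿cong (*-congʳ (distance d k≡)) ⟩
      - (- Z * P k j)            ≈⟨ -‿cong (-‿distribˡ-* _ _) ⟨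
      - - (Z * P k j)            ≈⟨ -‿involutive _ ⟩
      Z * P k j                  ≈⟨ adjacent j≡1+k ⟩
      - Z                        ∎
      where
      k<n : suc (d +ℕ toℕ i) ℕ.< n
      k<n = ℕ.<-trans (ℕ.≤-reflexive (≡.sym eq)) (Fin.toℕ<n j)
      k : Fin n
      k = Fin.fromℕ< k<n
      k≡ : toℕ k ≡ suc (d +ℕ toℕ i)
      k≡ = Fin.toℕ-fromℕ< k<n
      j≡1+k : toℕ j ≡ suc (toℕ k)
      j≡1+k = ≡.trans eq (≡.cong suc (≡.sym k≡))
      i≢ : ∀ (t : Fin n) {e} → toℕ i ℕ.≤ e → toℕ t ≡ suc e → i ≢ t
      i≢ t i≤e eq ≡.refl = ℕ.1+n≰n (≡.subst (ℕ._≤ _) eq i≤e)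

    ordered : ∀ {i j} → i Fin.< j → Z * P i j ≈ - Z
    ordered {i} {j} i<j = distance (toℕ j ∸ suc (toℕ i))
      (≡.sym (≡.trans (≡.sym (ℕ.+-suc _ (toℕ i))) (ℕ.m∸n+n≡m i<j)))

    go : Tri (i Fin.< j) (toℕ i ≡ toℕ j) (j Fin.< i) → Z * P i j ≈ - Z
    go (tri< i<j _ _) = ordered i<j
    go (tri≈ _ i≡j _) = contradiction (Fin.toℕ-injective i≡j) i≢j
    go (tri> _ _ j<i) = trans (*-congˡ (P-sym i j)) (ordered j<i)

  module _ (q : ℕ → Carrier) (q-central : ∀ d → Central (q d))
           (q-difference : ∀ d k → q (d +ℕ k) ≈ q d + k ×′ (q d * q (d +ℕ k))) where

    -- Induction on `L` for all `Z`, with the first factor absorbed into `Z`. The coefficient on the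
    -- right depends on `n` but not on `L`, so the induction hypothesis for the tail already has the
    -- final one. The factors `F` are given up to `≈` because `R` is written with `•`.
    straighten : ∀ {k Z L} (F : Fin n → Carrier) →
      (∀ j → F j ≈ 1# + - (q (suc (toℕ k) +ℕ suc (toℕ j) ∸ 2) * P k j)) →
      Run L → Unique L → k ∉ L → Antisymmetric L Z →
      Z * ∏ L F ≈ Z * (1# + - (q (suc (toℕ k) +ℕ n ∸ 2) * ∑ L (P k)))
    straighten {k} {Z} F F≈ [] u k∉ anti = *-congˡ (sym (begin
      1# + - (q (suc (toℕ k) +ℕ n ∸ 2) * 0#)   ≈⟨ +-congˡ (-‿cong (zeroʳ _)) ⟩
      1# + - 0#                                 ≈⟨ +-congˡ -0#≈0# ⟩
      1# + 0#                                   ≈⟨ +-identityʳ _ ⟩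
      1#                                        ∎))
    straighten {k} {Z} {j ∷ L} F F≈ (run _ len r) (j∉ ∷ u) k∉ anti = begin
      Z * (F j * ∏ L F)                    ≈⟨ *-assoc _ _ _ ⟨
      Z * F j * ∏ L F                      ≈⟨ straighten F F≈ r u (k∉ ∘ there) anti′ ⟩
      Z * F j * (1# + - (y * S))           ≈⟨ *-1-xX (Z * F j) S (q-central _) ⟩
      Z * F j + - (y * (Z * F j * S))      ≈⟨ +-cong ZF≈ (-‿cong (*-congˡ ZFS≈)) ⟩
      (Z + - (x * (Z * Q))) + - (y * (Z * S + x * (m ×′ (Z * Q))))
                                           ≈⟨ +-assoc _ _ _ ⟩
      Z + (- (x * (Z * Q)) + - (y * (Z * S + x * (m ×′ (Z * Q)))))
                                           ≈⟨ +-congˡ (-‿+-comm _ _) ⟩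
      Z + - (x * (Z * Q) + y * (Z * S + x * (m ×′ (Z * Q))))
                                           ≈⟨ +-congˡ (-‿cong coefficients) ⟩
      Z + - (y * (Z * (Q + S)))            ≈⟨ *-1-xX Z (Q + S) (q-central _) ⟨
      Z * (1# + - (y * (Q + S)))           ∎
      where
      Q S x y : Carrier
      Q = P k j
      S = ∑ L (P k)
      x = q (suc (toℕ k) +ℕ suc (toℕ j) ∸ 2)
      y = q (suc (toℕ k) +ℕ n ∸ 2)
      m = length L

      k≢ : ∀ {i} → i ∈ L → k ≢ i
      k≢ i∈ ≡.refl = k∉ (there i∈)

      anti′ : Antisymmetric L (Z * F j)
      anti′ = antisymmetric-* (antisymmetric-tail anti) λ {s} {t} s∈ t∈ _ →
        trans (*-congʳ (F≈ j)) (trans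
          (commute-1-xX (q-central _) (P-comm (k≢ s∈) (k≢ t∈) (All.lookup j∉ s∈) (All.lookup j∉ t∈)))
          (*-congˡ (sym (F≈ j))))

      ZF≈ : Z * F j ≈ Z + - (x * (Z * Q))
      ZF≈ = trans (*-congˡ (F≈ j)) (*-1-xX Z Q (q-central _))

      -- As `k` is not in the list, antisymmetry says nothing about `P k i` directly; `P-star`
      -- trades it for `P j i`, whose labels both belong to the list.
      ZQS≈ : Z * Q * S ≈ - (m ×′ (Z * Q))
      ZQS≈ = begin
        Z * Q * S                             ≈⟨ ∑-distribˡ L _ _ ⟩
        ∑ L (λ i → Z * Q * P k i)             ≈⟨ ∑-cong-All (All.tabulate λ {i} i∈ → begin
          Z * Q * P k i                         ≈⟨ *-assoc _ _ _ ⟩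
          Z * (P k j * P k i)                   ≈⟨ *-congˡ (P-star (k≢ i∈) (All.lookup j∉ i∈)) ⟩
          Z * (P j i * P k j)                   ≈⟨ *-assoc _ _ _ ⟨
          Z * P j i * P k j                     ≈⟨ *-congʳ (anti (here ≡.refl) (there i∈) (All.lookup j∉ i∈)) ⟩
          - Z * Q                               ≈⟨ *-congʳ (-1*x≈-x Z) ⟨
          - 1# * Z * Q                          ≈⟨ *-assoc _ _ _ ⟩
          - 1# * (Z * Q)                        ∎) ⟩
        ∑ L (λ _ → - 1# * (Z * Q))            ≈⟨ ∑-distribˡ L _ _ ⟨
        - 1# * ∑ L (λ _ → Z * Q)              ≈⟨ -1*x≈-x _ ⟩
        - ∑ L (λ _ → Z * Q)                   ≈⟨ -‿cong (∑-const L _) ⟩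
        - (m ×′ (Z * Q))                      ∎

      ZFS≈ : Z * F j * S ≈ Z * S + x * (m ×′ (Z * Q))
      ZFS≈ = begin
        Z * F j * S                           ≈⟨ *-congʳ ZF≈ ⟩
        (Z + - (x * (Z * Q))) * S             ≈⟨ distribʳ _ _ _ ⟩
        Z * S + - (x * (Z * Q)) * S           ≈⟨ +-congˡ (-‿distribˡ-* _ _) ⟨
        Z * S + - (x * (Z * Q) * S)           ≈⟨ +-congˡ (-‿cong (*-assoc _ _ _)) ⟩
        Z * S + - (x * (Z * Q * S))           ≈⟨ +-congˡ (-‿distribʳ-* _ _) ⟩
        Z * S + x * - (Z * Q * S)             ≈⟨ +-congˡ (*-congˡ (trans (-‿cong ZQS≈) (-‿involutive _))) ⟩
        Z * S + x * (m ×′ (Z * Q))            ∎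

      -- By `len`, `suc (toℕ j) + m` equals `n`, so the index of `y` exceeds that of `x` by the
      -- number `m` of transpositions still to come.
      y≈ : y ≈ x + m ×′ (y * x)
      y≈ = trans (reflexive (≡.cong q (index-+ (toℕ k) len))) (trans (q-difference _ m)
        (+-congˡ (×-congʳ m (trans (q-central _ _) (*-congʳ (reflexive (≡.cong q (≡.sym (index-+ (toℕ k) len)))))))))

      -- The total coefficient of `Z * Q` is x + m y x, which `y≈` contracts to `y`, the coefficient
      -- that `Z * S` already has.
      coefficients : x * (Z * Q) + y * (Z * S + x * (m ×′ (Z * Q))) ≈ y * (Z * (Q + S))
      coefficients = begin
        x * (Z * Q) + y * (Z * S + x * (m ×′ (Z * Q)))
          ≈⟨ +-congˡ (trans (distribˡ _ _ _) (+-comm _ _)) ⟩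
        x * (Z * Q) + (y * (x * (m ×′ (Z * Q))) + y * (Z * S))
          ≈⟨ +-assoc _ _ _ ⟨
        x * (Z * Q) + y * (x * (m ×′ (Z * Q))) + y * (Z * S)
          ≈⟨ +-congʳ (+-congˡ (trans (sym (*-assoc _ _ _)) (trans (×-comm-* m _ _) (sym (×-assoc-* m _ _))))) ⟩
        x * (Z * Q) + (m ×′ (y * x)) * (Z * Q) + y * (Z * S)
          ≈⟨ +-congʳ (distribʳ _ _ _) ⟨
        (x + m ×′ (y * x)) * (Z * Q) + y * (Z * S)
          ≈⟨ +-congʳ (*-congʳ y≈) ⟨
        y * (Z * Q) + y * (Z * S)
          ≈⟨ distribˡ _ _ _ ⟨
        y * (Z * Q + Z * S)
          ≈⟨ *-congˡ (distribˡ _ _ _) ⟨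
        y * (Z * (Q + S)) ∎

-- The series 1/(αu - d) as central elements of the tensor algebra

module ReflectionSeries
  (K : HeytingField c ℓ₁ ℓ₂) (char0 : CharacteristicZero K) (m l : ℕ) where

  open SklyaninDeterminant K char0 m l using (reciprocal)

  private
    K-ring = field-commutativeRing K
    module K = CommutativeRing K-ring
    module KFold = ListFolds K.rawRing
    module KMult = SemiringMult K.semiring
    module 𝓑 = ReflectionAlgebra K m l
    module 𝓑R = Ring 𝓑.ring
    module 𝓑Fold = ListFolds 𝓑.rawRing
    module 𝓑Mult = SemiringMult 𝓑R.semiring
    open PowerSeriesRing K.ring
    open RawRing (PowerSeries K.rawRing)
      using () renaming (Carrier to KSeries; _*_ to _*ˢ_; _+_ to _+ˢ_; _≈_ to _≈ˢ_; 1# to 1ˢ)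
    open 𝓑 using (scalar; n)

  module _ (α⁻¹ : K.Carrier) where
    open K

    private
      ⟦_⟧ : ℕ → Carrier
      ⟦ d ⟧ = d KMult.× 1#

    -- This is the identity (αu - d)/(αu - d) = 1 solved for the leading term.
    reciprocal-suc : ∀ d r → reciprocal α⁻¹ d (suc r) ≈ α⁻¹ * (1ˢ r + ⟦ d ⟧ * reciprocal α⁻¹ d r)
    reciprocal-suc d zero    = *-congˡ (sym (trans (+-congˡ (zeroʳ _)) (+-identityʳ 1#)))
    reciprocal-suc d (suc r) = *-congˡ (trans (*-assoc _ _ _) (sym (+-identityˡ _)))

    private
      -- Induction on the degree through `reciprocal-suc`. The multiple is written as a product with
      -- `⟦ k ⟧`, so that each step is an identity for the commutative ring solver.
      reciprocal-difference′ : ∀ d k r → reciprocal α⁻¹ (d +ℕ k) r ≈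
        reciprocal α⁻¹ d r + ⟦ k ⟧ * (reciprocal α⁻¹ d *ˢ reciprocal α⁻¹ (d +ℕ k)) r
      reciprocal-difference′ d k zero = sym (trans (+-identityˡ _)
        (trans (*-congˡ (trans (*ˢ-zero (reciprocal α⁻¹ d) (reciprocal α⁻¹ (d +ℕ k))) (zeroˡ _))) (zeroʳ _)))
      reciprocal-difference′ d k (suc r) = begin
        g (suc r)
          ≈⟨ reciprocal-suc (d +ℕ k) r ⟩
        α⁻¹ * (1ˢ r + ⟦ d +ℕ k ⟧ * g r)
          -- The induction hypothesis rewrites only the summand with `⟦ d ⟧`; the summand
          -- `⟦ k ⟧ * g r` is kept, as it enters the recursion for the product f g.
          ≈⟨ *-congˡ (+-congˡ (trans (*-congʳ (KMult.×-homo-+ 1# d k)) (trans (distribʳ _ _ _)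
               (+-congʳ (*-congˡ (reciprocal-difference′ d k r)))))) ⟩
        α⁻¹ * (1ˢ r + (⟦ d ⟧ * (f r + ⟦ k ⟧ * (f *ˢ g) r) + ⟦ k ⟧ * g r))
          ≈⟨ solve 7 (λ x o D E f p g →
               x :* (o :+ (D :* (f :+ E :* p) :+ E :* g)) :=
               x :* (o :+ D :* f) :+ E :* (x :* (g :+ D :* p)))
               refl α⁻¹ (1ˢ r) ⟦ d ⟧ ⟦ k ⟧ (f r) ((f *ˢ g) r) (g r) ⟩
        α⁻¹ * (1ˢ r + ⟦ d ⟧ * f r) + ⟦ k ⟧ * (α⁻¹ * (g r + ⟦ d ⟧ * (f *ˢ g) r))
          ≈⟨ +-cong (reciprocal-suc d r) (*-congˡ product) ⟨
        f (suc r) + ⟦ k ⟧ * (f *ˢ g) (suc r) ∎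
        where
        open import Relation.Binary.Reasoning.Setoid setoid
        open RingSolver commutativeSemiring using (solve; _:=_; _:+_; _:*_)
        f g : KSeries
        f = reciprocal α⁻¹ d
        g = reciprocal α⁻¹ (d +ℕ k)
        -- Multiplying the recursion of `f` by `g`; `f` has constant coefficient 0, so the first
        -- summand of `*ˢ-suc` vanishes.
        product : (f *ˢ g) (suc r) ≈ α⁻¹ * (g r + ⟦ d ⟧ * (f *ˢ g) r)
        product = begin
          (f *ˢ g) (suc r)
            ≈⟨ *ˢ-suc f g r ⟩
          0# * g (suc r) + ((f ∘ suc) *ˢ g) r
            ≈⟨ +-cong (zeroˡ _) (*ˢ-cong {g = g} (reciprocal-suc d) (λ _ → refl) r) ⟩
          0# + ((λ s → α⁻¹ * (1ˢ s + ⟦ d ⟧ * f s)) *ˢ g) r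
            ≈⟨ trans (+-identityˡ _) (*ˢ-scaleˡ α⁻¹ (λ s → 1ˢ s + ⟦ d ⟧ * f s) g r) ⟩
          α⁻¹ * ((1ˢ +ˢ (λ s → ⟦ d ⟧ * f s)) *ˢ g) r
            ≈⟨ *-congˡ (*ˢ-distribʳ g 1ˢ (λ s → ⟦ d ⟧ * f s) r) ⟩
          α⁻¹ * ((1ˢ *ˢ g) r + ((λ s → ⟦ d ⟧ * f s) *ˢ g) r)
            ≈⟨ *-congˡ (+-cong (*ˢ-identityˡ g r) (*ˢ-scaleˡ ⟦ d ⟧ f g r)) ⟩
          α⁻¹ * (g r + ⟦ d ⟧ * (f *ˢ g) r) ∎

    -- 1/(αu - d - k) - 1/(αu - d) = k/((αu - d)(αu - d - k))
    reciprocal-difference : ∀ d k r → reciprocal α⁻¹ (d +ℕ k) r ≈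
      reciprocal α⁻¹ d r + k KMult.× (reciprocal α⁻¹ d *ˢ reciprocal α⁻¹ (d +ℕ k)) r
    reciprocal-difference d k r = trans (reciprocal-difference′ d k r)
      (+-congˡ (trans (KMult.×-assoc-* k 1# _) (KMult.×-congʳ k (*-identityˡ _))))

  scalar-∑ : {I : Set a} (is : List I) (f : I → K.Carrier) →
             scalar (KFold.∑ is f) 𝓑.≈ 𝓑Fold.∑ is (scalar ∘ f)
  scalar-∑ []       f = 𝓑R.refl
  scalar-∑ (i ∷ is) f = 𝓑R.trans (𝓑.scalar-⊕ _ _) (𝓑R.+-congˡ (scalar-∑ is f))

  scalar-× : ∀ k x → scalar (k KMult.× x) 𝓑.≈ k 𝓑Mult.× scalar x
  scalar-× zero    x = 𝓑R.refl
  scalar-× (suc k) x = 𝓑R.trans (𝓑.scalar-⊕ _ _) (𝓑R.+-congˡ (scalar-× k x))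

  𝓢 : Ring _ _
  𝓢 = powerSeriesRing 𝓑.ring

  module 𝓢 = Ring 𝓢
  module 𝓢Mult = SemiringMult 𝓢.semiring

  scalarSeries : (ℕ → K.Carrier) → 𝓢.Carrier
  scalarSeries f r = scalar (f r)

  scalarSeries-central : ∀ f g → (scalarSeries f 𝓢.* g) 𝓢.≈ (g 𝓢.* scalarSeries f)
  scalarSeries-central f g =
    PowerSeriesRing.*ˢ-central 𝓑.ring (scalarSeries f) (λ r → 𝓑.scalar-central (f r)) g

  scalarSeries-* : ∀ f g → scalarSeries (f *ˢ g) 𝓢.≈ (scalarSeries f 𝓢.* scalarSeries g)
  scalarSeries-* f g r = 𝓑R.trans (scalar-∑ (upTo (suc r)) (λ s → f s K.* g (r ∸ s)))
    (FoldProperties.∑-cong 𝓑.ring (upTo (suc r)) (λ s → 𝓑.scalar-⊗ _ _))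

  𝓢-× : ∀ k f r → (k 𝓢Mult.× f) r ≡ k 𝓑Mult.× f r
  𝓢-× zero    f r = ≡.refl
  𝓢-× (suc k) f r = ≡.cong (f r 𝓑R.+_) (𝓢-× k f r)

  scalarReciprocal : K.Carrier → ℕ → 𝓢.Carrier
  scalarReciprocal α⁻¹ d = scalarSeries (reciprocal α⁻¹ d)

  scalarReciprocal-difference : ∀ α⁻¹ d k → let q = scalarReciprocal α⁻¹ in
    q (d +ℕ k) 𝓢.≈ (q d 𝓢.+ (k 𝓢Mult.× (q d 𝓢.* q (d +ℕ k))))
  scalarReciprocal-difference α⁻¹ d k r =
    𝓑R.trans (𝓑.scalar-cong (reciprocal-difference α⁻¹ d k r))
    (𝓑R.trans (𝓑.scalar-⊕ _ _) (𝓑R.+-congˡ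
    (𝓑R.trans (scalar-× k _)
    (𝓑R.trans (𝓑Mult.×-congʳ k (scalarSeries-* (reciprocal α⁻¹ d) (reciprocal α⁻¹ (d +ℕ k)) r))
    (𝓑R.reflexive (≡.sym (𝓢-× k _ r)))))))

  𝓜 : Ring _ _
  𝓜 = endTensorRing n n 𝓢

  module 𝓜 = Ring 𝓜
  module 𝓜Mult = SemiringMult 𝓜.semiring
  open MatrixScalars {I = Vec (Fin n) n} 𝓢.rawRing using (_•_)
  private
    module Mat = MatrixRing _≟ᵛ_ (allVectors-unique n n) allVectors-complete 𝓢

  𝓜-× : ∀ k X I J → (k 𝓜Mult.× X) I J ≡ k 𝓢Mult.× X I J
  𝓜-× zero    X I J = ≡.refl
  𝓜-× (suc k) X I J = ≡.cong (X I J 𝓢.+_) (𝓜-× k X I J)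

  -- The scalar matrix of 1/(αu - d); in this form the series is a central element of `𝓜`.
  q : K.Carrier → ℕ → 𝓜.Carrier
  q α⁻¹ d = scalarReciprocal α⁻¹ d • 𝓜.1#

  q-* : ∀ α⁻¹ d X → (q α⁻¹ d 𝓜.* X) 𝓜.≈ (scalarReciprocal α⁻¹ d • X)
  q-* α⁻¹ d = Mat.•1-*ˡ (scalarSeries-central (reciprocal α⁻¹ d))

  q-central : ∀ α⁻¹ d X → (q α⁻¹ d 𝓜.* X) 𝓜.≈ (X 𝓜.* q α⁻¹ d)
  q-central α⁻¹ d X = 𝓜.trans (q-* α⁻¹ d X)
    (𝓜.sym (Mat.•1-*ʳ (scalarSeries-central (reciprocal α⁻¹ d)) X))

  q-difference : ∀ α⁻¹ d k →
    q α⁻¹ (d +ℕ k) 𝓜.≈ (q α⁻¹ d 𝓜.+ (k 𝓜Mult.× (q α⁻¹ d 𝓜.* q α⁻¹ (d +ℕ k))))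
  q-difference α⁻¹ d k I J = begin
    y 𝓢.* δ                                        ≈⟨ 𝓢.*-congʳ (scalarReciprocal-difference α⁻¹ d k) ⟩
    (x 𝓢.+ (k 𝓢Mult.× (x 𝓢.* y))) 𝓢.* δ            ≈⟨ 𝓢.distribʳ _ _ _ ⟩
    x 𝓢.* δ 𝓢.+ (k 𝓢Mult.× (x 𝓢.* y)) 𝓢.* δ        ≈⟨ 𝓢.+-congˡ {x 𝓢.* δ} (𝓢.trans (𝓢Mult.×-assoc-* k (x 𝓢.* y) δ)
                                                       (𝓢Mult.×-congʳ k (𝓢.trans (𝓢.*-assoc x y δ)
                                                         (𝓢.sym (q-* α⁻¹ d (q α⁻¹ (d +ℕ k)) I J))))) ⟩
    x 𝓢.* δ 𝓢.+ (k 𝓢Mult.× (q α⁻¹ d 𝓜.* q α⁻¹ (d +ℕ k)) I J)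
                                                   ≡⟨ ≡.cong (x 𝓢.* δ 𝓢.+_) (𝓜-× k _ I J) ⟨
    x 𝓢.* δ 𝓢.+ (k 𝓜Mult.× (q α⁻¹ d 𝓜.* q α⁻¹ (d +ℕ k))) I J ∎
    where
    open import Relation.Binary.Reasoning.Setoid 𝓢.setoid
    x = scalarReciprocal α⁻¹ d
    y = scalarReciprocal α⁻¹ (d +ℕ k)
    δ = 𝓜.1# I J

-- Replacing the products by Π_k inside the word

module _ (K : HeytingField c ℓ₁ ℓ₂) (char0 : CharacteristicZero K) (m l : ℕ) where
  open SklyaninDeterminant K char0 m l hiding (above)
  open ReflectionSeries K char0 m l
  private
    n : ℕ
    n = m +ℕ l
  open TensorOps n n 𝓢.rawRing using (P; at)
  open TensorProperties n n 𝓢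
  open Straightening 𝓜 P P-conjugate
  open FoldProperties 𝓜
  open ListFolds 𝓜.rawRing
  open import Relation.Binary.Reasoning.Setoid 𝓜.setoid

  RR : Fin n → 𝓜.Carrier
  RR k = ∏ (above k) (R k)

  -- Translates the `•` in the definitions of `R` and `Π` into the ring product used by the
  -- straightening.
  1-q*X≈ : ∀ d X → (𝓜.1# 𝓜.+ 𝓜.- (scalarReciprocal (half K char0) d • X)) 𝓜.≈
                    (𝓜.1# 𝓜.+ 𝓜.- (q (half K char0) d 𝓜.* X))
  1-q*X≈ d X = 𝓜.+-congˡ {𝓜.1#} (𝓜.-‿cong (𝓜.sym (q-* (half K char0) d X)))

  -- `Z` is arbitrary because Aₙ becomes Aₙ B_1 Π_1 ⋯ B_k Π_k along the induction, and of its
  -- antisymmetry only the part over the labels after k is carried along.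
  straighten-interleave : ∀ {ks Z} → Run ks → Antisymmetric ks Z →
                          (Z · interleave 𝔹 RR ks) 𝓜.≈ (Z · interleave 𝔹 Π ks)
  straighten-interleave []                          anti = 𝓜.refl
  -- The last label is followed by neither a product nor a Π, so both words are just `𝔹 k`.
  straighten-interleave (run {k} {[]} _ _ _)        anti = 𝓜.refl
  straighten-interleave {Z = Z} (run {k} {ks@(_ ∷ _)} above≡ks _ r) anti = begin
    Z · (𝔹 k · (RR k · W RR))     ≈⟨ 𝓜.*-assoc Z (𝔹 k) (RR k · W RR) ⟨
    (Z · 𝔹 k) · (RR k · W RR)     ≈⟨ 𝓜.*-assoc (Z · 𝔹 k) (RR k) (W RR) ⟨
    ((Z · 𝔹 k) · RR k) · W RR     ≈⟨ 𝓜.*-congʳ {W RR} straightened ⟩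
    ((Z · 𝔹 k) · Π k) · W RR      ≈⟨ straighten-interleave r anti-Π ⟩
    ((Z · 𝔹 k) · Π k) · W Π       ≈⟨ 𝓜.*-assoc (Z · 𝔹 k) (Π k) (W Π) ⟩
    (Z · 𝔹 k) · (Π k · W Π)       ≈⟨ 𝓜.*-assoc Z (𝔹 k) (Π k · W Π) ⟩
    Z · (𝔹 k · (Π k · W Π))       ∎
    where
    W : (Fin n → 𝓜.Carrier) → 𝓜.Carrier
    W Y = interleave 𝔹 Y ks

    d : ℕ
    d = (label k +ℕ n) ∸ 2

    k∉ : k ∉ ks
    k∉ = ≡.subst (k ∉_) above≡ks (∉-above k)

    k≢ : ∀ {i} → i ∈ ks → k ≢ i
    k≢ i∈ ≡.refl = k∉ i∈

    anti-𝔹 : Antisymmetric ks (Z · 𝔹 k)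
    anti-𝔹 = antisymmetric-* {Z = Z} {𝔹 k} (antisymmetric-tail {Z = Z} anti)
      (λ i∈ j∈ _ → at-P-comm (λ i j → shift (label k ∸ 1) (ReflectionAlgebra.B K m l i j)) (k≢ i∈) (k≢ j∈))

    Π≈ : Π k 𝓜.≈ (𝓜.1# 𝓜.+ 𝓜.- (q (half K char0) d 𝓜.* ∑ (above k) (P k)))
    Π≈ = 1-q*X≈ d (∑ (above k) (P k))

    straightened : ((Z · 𝔹 k) · RR k) 𝓜.≈ ((Z · 𝔹 k) · Π k)
    straightened = 𝓜.trans
      (straighten (q (half K char0)) (q-central (half K char0)) (q-difference (half K char0)) {Z = Z · 𝔹 k}
        (R k) (λ j → 1-q*X≈ ((label k +ℕ label j) ∸ 2) (P k j))
        (≡.subst Run (≡.sym above≡ks) r) (above-unique k) (∉-above k)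
        (≡.subst (λ L → Antisymmetric L (Z · 𝔹 k)) (≡.sym above≡ks) anti-𝔹))
      (𝓜.*-congˡ {Z · 𝔹 k} (𝓜.sym Π≈))

    Π-commutes : CommutesWithP ks (Π k)
    Π-commutes {i} {j} i∈ j∈ i≢j = 𝓜.trans (𝓜.*-congʳ {P i j} Π≈) (𝓜.trans
      (commute-1-xX {q (half K char0) d} {∑ (above k) (P k)} {P i j} (q-central (half K char0) d)
        (≡.subst (λ L → CommutesWithP L (∑ (above k) (P k))) above≡ks
          (∑P-commutes (above-unique k) (∉-above k)) i∈ j∈ i≢j))
      (𝓜.*-congˡ {P i j} (𝓜.sym Π≈)))

    anti-Π : Antisymmetric ks ((Z · 𝔹 k) · Π k)
    anti-Π = antisymmetric-* {Z = Z · 𝔹 k} {Π k} anti-𝔹 Π-commutes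

  A-⟨B⟩≋A-⟨⟨B⟩⟩ : A · ⟨B⟩ ≋ A · ⟨⟨B⟩⟩
  A-⟨B⟩≋A-⟨⟨B⟩⟩ = straighten-interleave (run-allFin n)
    (adjacent⇒antisymmetric {A} P-sym (AntisymmetrizerProperties.A-adjacent n 𝓢))

proposition2 : ∀ {c ℓ₁ ℓ₂} (K : HeytingField c ℓ₁ ℓ₂) (char0 : CharacteristicZero K) (m l : ℕ) →
    let open SklyaninDeterminant K char0 m l in
    (sdet : Series) → IsSdet sdet → A · ⟨⟨B⟩⟩ ≋ sdet • A
proposition2 K char0 m l sdet isSdet = 𝓜.trans (𝓜.sym (A-⟨B⟩≋A-⟨⟨B⟩⟩ K char0 m l)) isSdet
  where open ReflectionSeries K char0 m l
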